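{- Let $T$ be a noncrossing tree on the vertex set $[n]$, and let $R_T(x_{ij}\mid 1\le i<j\le n)$ be an arbitrary reduced form of the monomial $m[T]$. Let $R_T(t_1,\ldots,t_{n-1})$ be the polynomial obtained from $R_T(x_{ij}\mid 1\le i<j\le n)$ by setting $x_{ij}=t_i$ for all $1\le i<j\le n$. Then $$R_T(t_1,\ldots,t_{n-1})=\mathrm{Crf}_T(t_1,\ldots,t_{n-1}).$$
   Context: A graph on $[n]$ is noncrossing if there are no $i<j<k<l$ such that $(i,k)$ and $(j,l)$ are both edges. The subdivision algebra $\mathcal{S}(\beta)$ is the commutative algebra over $\mathbb{Q}[\beta]$ generated by $x_{ij}$, $1\le i<j\le n$, subject to the relations $x_{ij}x_{jk}=x_{ik}(x_{ij}+x_{jk}+\beta)$ for $1\le i<j<k\le n$. A reduced form of a monomial is a polynomial obtained by successively substituting $x_{ik}(x_{ij}+x_{jk}+\beta)$ in place of an occurrence of $x_{ij}x_{jk}$ ($i<j<k$), the reductions being performed on each monomial separately, until no further reduction is possible. Reduced forms need not be unique. For a noncrossing tree $T$ on $[n]$, $m[T]=\prod_{(i,j)\in E(T),\,i<j}x_{ij}$. The canonical reduced form $\mathrm{Crf}_T(x_{ij}\mid 1\le i<j\le n)$ of $m[T]$ is the reduced form obtained by performing the reductions from front to back (or back to front) along the vertices $1,2,\ldots,n$, always on the topmost edges: at a vertex $j$ at which there are both an edge $(i,j)$ with $i<j$ and an edge $(j,k)$ with $j<k$, the reduction is performed on the pair with $i$ smallest and $k$ largest. $\mathrm{Crf}_T(t_1,\ldots,t_{n-1})$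 denotes $\mathrm{Crf}_T$ with $x_{ij}=t_i$ for all $i<j$. -}

module Defs where

open import Data.Fin.Base using (Fin; toℕ; lower; _<_)
open import Data.Fin.Properties using (toℕ≤pred[n]; <-irrelevant; ≤-decTotalOrder)
import Data.Fin.Properties as Fin
open import Data.List.Base
  using (List; []; _∷_; [_]; _++_; _∷ʳ_; map; mapMaybe; concatMap; foldl; filter; allFin; reverse; length)
open import Data.List.Membership.Propositional using (_∈_)
open import Data.List.Membership.Propositional.Properties using (∈-∃++)
open import Data.List.Relation.Binary.Permutation.Propositional
  using (_↭_; ↭-refl; ↭-sym; ↭-trans; ↭-prep)
open import Data.List.Relation.Binary.Permutation.Propositional.Properties
  using (∈-resp-↭; drop-∷; shift; ¬x∷xs↭[])
import Data.List.Sort.InsertionSort as InsertionSort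
open import Data.List.Relation.Unary.All using (All)
open import Data.List.Relation.Unary.Any using (here)
open import Data.List.Relation.Unary.Linked using (Linked)
open import Data.List.Relation.Unary.Unique.Propositional using (Unique)
import Data.List.Membership.DecPropositional as DecMembership
open import Data.Maybe.Base using (Maybe; just; nothing)
open import Data.Nat.Base as ℕ using (ℕ; suc; pred; NonZero)
import Data.Nat.Properties as ℕ
open import Data.Product.Base using (∃-syntax; Σ-syntax; _×_; _,_; proj₁)
open import Data.Rational.Base using (ℚ; 0ℚ; 1ℚ) renaming (_+_ to _+ℚ_)
open import Data.Sum.Base using (_⊎_)
open import Relation.Binary.Bundles using (DecTotalOrder)
open import Relation.Binary.Construct.Closure.ReflexiveTransitive using (Star)
import Relation.Binary.Construct.Flip.EqAndOrd as Flip
import Relation.Binary.Construct.On as On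
open import Relation.Binary.Definitions using (DecidableEquality)
open import Relation.Binary.PropositionalEquality using (_≡_; refl; sym; cong)
open import Relation.Nullary using (¬_; Dec; yes; no; ¬?)
open import Relation.Nullary.Decidable using (map′; _×-dec_)

-- A monomial in the commuting variables V is a finite multiset of
-- variables: a list, considered up to permutation _↭_.
Monomial : Set → Set
Monomial V = List V

-- term c b m stands for c βᵇ m.
record Term (V : Set) : Set where
  constructor term
  field
    coefficient : ℚ
    βpower      : ℕ
    monomial    : Monomial V

open Term public

-- A polynomial in ℚ[β][V] is represented by a formal sum of terms, in which like
-- terms need not be collected; equality of polynomials is _≈_ below.
Poly : Set → Set
Poly V = List (Term V)

module PolyEquality {V : Set} (_≟_ : DecidableEquality V) where

  open DecMembership _≟_ using (_∈?_)

  _↭?_ : (m m′ : Monomial V) → Dec (m ↭ m′)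
  []      ↭? []       = yes ↭-refl
  []      ↭? (_ ∷ _)  = no λ p → ¬x∷xs↭[] (↭-sym p)
  (x ∷ m) ↭? m′ with x ∈? m′
  ... | no  x∉m′ = no λ p → x∉m′ (∈-resp-↭ p (here refl))
  ... | yes x∈m′ with ∈-∃++ x∈m′
  ...   | ys , zs , refl =
    map′ (λ p → ↭-trans (↭-prep x p) (↭-sym (shift x ys zs)))
         (λ p → drop-∷ (↭-trans p (shift x ys zs)))
         (m ↭? (ys ++ zs))

  -- The coefficient of βᵇ m.
  coeff : ℕ → Monomial V → Poly V → ℚ
  coeff b m []                = 0ℚ
  coeff b m (term c b′ m′ ∷ p) with (b′ ℕ.≟ b) ×-dec (m′ ↭? m)
  ... | yes _ = c +ℚ coeff b m p
  ... | no  _ = coeff b m p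

  infix 4 _≈_

  _≈_ : Poly V → Poly V → Set
  p ≈ q = ∀ b m → coeff b m p ≡ coeff b m q

-- The substitution homomorphism ℚ[β][V] → ℚ[β][W] sending the variable
-- v to the variable f v.
substitute : {V W : Set} → (V → W) → Poly V → Poly W
substitute f = map λ { (term c b m) → term c b (map f m) }

-- A pair i < j; it serves both as an edge and as (the index of) the
-- variable x_ij.
record Edge (n : ℕ) : Set where
  constructor edge
  field
    {src tgt} : Fin n
    src<tgt   : src < tgt

open Edge public

_≟ᴱ_ : ∀ {n} → DecidableEquality (Edge n)
edge {i} {j} p ≟ᴱ edge {k} {l} q with i Fin.≟ k | j Fin.≟ l
... | yes refl | yes refl = yes (cong edge (<-irrelevant p q))
... | no  i≢k  | _        = no λ { refl → i≢k refl }
... | yes _    | no j≢l   = no λ { refl → j≢l refl }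

record Graph (n : ℕ) : Set where
  field
    edges  : List (Edge n)
    simple : Unique edges

open Graph public

module _ {n : ℕ} (G : Graph n) where

  Adjacent : Fin n → Fin n → Set
  Adjacent u v =
    ∃[ e ] e ∈ edges G × ((src e ≡ u × tgt e ≡ v) ⊎ (src e ≡ v × tgt e ≡ u))

  -- The vertices v ∷ vs, in this order, form a cycle.
  IsCycle : Fin n → List (Fin n) → Set
  IsCycle v vs =
    Unique (v ∷ vs) × 2 ℕ.≤ length vs × Linked Adjacent (v ∷ (vs ∷ʳ v))

  record IsTree : Set where
    field
      nonempty  : NonZero n
      connected : ∀ u v → Star Adjacent u v
      acyclic   : ∀ v vs → ¬ IsCycle v vs

  Noncrossing : Set
  Noncrossing = ∀ {e f} → e ∈ edges G → f ∈ edges G →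
    ¬ (src e < src f × src f < tgt e × tgt e < tgt f)

  m[_] : Monomial (Edge n)
  m[_] = edges G

module _ {n : ℕ} where

  open PolyEquality (_≟ᴱ_ {n}) using (_≈_)

  x : {i j : Fin n} → i < j → Edge n
  x = edge

  monomialPoly : Monomial (Edge n) → Poly (Edge n)
  monomialPoly m = [ term 1ℚ 0 m ]

  -- Replacing one occurrence of x_ij x_jk by x_ik (x_ij + x_jk + β).
  data _⟿_ : Term (Edge n) → Poly (Edge n) → Set where
    reduce : ∀ {c b m} {i j k : Fin n} (i<j : i < j) (j<k : j < k) (r : Monomial (Edge n)) →
             m ↭ x i<j ∷ x j<k ∷ r →
             let i<k = Fin.<-trans i<j j<k in
             term c b m ⟿
               ( term c b       (x i<k ∷ x i<j ∷ r)
               ∷ term c b       (x i<k ∷ x j<k ∷ r)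
               ∷ term c (suc b) (x i<k ∷ r)
               ∷ [])

  -- A single term of the formal sum is reduced at a time.  Equal terms
  -- may be reduced differently; reducing a collected term amounts to
  -- reducing all of its copies in the same way.
  data _⟶_ : Poly (Edge n) → Poly (Edge n) → Set where
    step : ∀ ps qs {t q} → t ⟿ q → (ps ++ t ∷ qs) ⟶ (ps ++ q ++ qs)

  Irreducible : Monomial (Edge n) → Set
  Irreducible m = ∀ {e f} → e ∈ m → f ∈ m → ¬ (tgt e ≡ src f)

  -- All coefficients arising from a monomial are positive, so no
  -- cancellation can occur and a polynomial R admits no further reduction
  -- iff all terms of the formal sum p are irreducible.
  IsReducedForm : Monomial (Edge n) → Poly (Edge n) → Set
  IsReducedForm m R = ∃[ p ]
      Star _⟶_ (monomialPoly m) p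
    × All (λ t → Irreducible (monomial t)) p
    × R ≈ p

data Direction : Set where
  frontToBack backToFront : Direction

module _ {n : ℕ} where

  vertices : Direction → List (Fin n)
  vertices frontToBack = allFin n
  vertices backToFront = reverse (allFin n)

  module AtVertex (j : Fin n) where

    Below Above : Set
    Below = Σ[ i ∈ Fin n ] i < j
    Above = Σ[ k ∈ Fin n ] j < k

    below? : Edge n → Maybe Below
    below? (edge {i} {k} i<k) with k Fin.≟ j
    ... | yes refl = just (i , i<k)
    ... | no  _    = nothing

    above? : Edge n → Maybe Above
    above? (edge {i} {k} i<k) with i Fin.≟ j
    ... | yes refl = just (k , i<k)
    ... | no  _    = nothing

    xᴮ : Below → Edge n
    xᴮ (_ , i<j) = edge i<j

    xᴬ : Above → Edge n
    xᴬ (_ , j<k) = edge j<k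

    ≤ᴮ ≥ᴬ : DecTotalOrder _ _ _
    ≤ᴮ = On.decTotalOrder {B = Below} (≤-decTotalOrder n) proj₁
    ≥ᴬ = Flip.decTotalOrder (On.decTotalOrder {B = Above} (≤-decTotalOrder n) proj₁)

    -- Sorted with the smallest i first.
    incoming : Monomial (Edge n) → List Below
    incoming m = InsertionSort.sort ≤ᴮ (mapMaybe below? m)

    -- Sorted with the largest k first.
    outgoing : Monomial (Edge n) → List Above
    outgoing m = InsertionSort.sort ≥ᴬ (mapMaybe above? m)

    elsewhere : Monomial (Edge n) → Monomial (Edge n)
    elsewhere = filter λ e → ¬? (tgt e Fin.≟ j) ×-dec ¬? (src e Fin.≟ j)

    -- The edge x_ik created by a reduction does not touch j, so the heads
    -- of the two sorted lists remain the topmost edges at j throughout.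
    reduceTopmost : ℚ → ℕ → List Below → List Above → Monomial (Edge n) → Poly (Edge n)
    reduceTopmost c b ((i , i<j) ∷ is) ((k , j<k) ∷ ks) r =
         reduceTopmost c b       ((i , i<j) ∷ is) ks               r′
      ++ reduceTopmost c b       is               ((k , j<k) ∷ ks) r′
      ++ reduceTopmost c (suc b) is               ks               r′
      where r′ = x (Fin.<-trans i<j j<k) ∷ r
    reduceTopmost c b is ks r = [ term c b (map xᴮ is ++ map xᴬ ks ++ r) ]

    reduceAt : Term (Edge n) → Poly (Edge n)
    reduceAt (term c b m) = reduceTopmost c b (incoming m) (outgoing m) (elsewhere m)

  Crf : Direction → Graph n → Poly (Edge n)
  Crf d T = foldl (λ p j → concatMap (AtVertex.reduceAt j) p)
                  (monomialPoly m[ T ]) (vertices d)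

-- The variable t_i, 1 ≤ i ≤ n-1, has index i in Fin (pred n).
module _ {n : ℕ} where

  t : Edge n → Fin (pred n)
  t (edge {i} {j} i<j) = lower i (ℕ.≤-trans i<j (toℕ≤pred[n] j))

  setTo-t : Poly (Edge n) → Poly (Fin (pred n))
  setTo-t = substitute t

module _ {k : ℕ} where

  open PolyEquality (Fin._≟_ {k}) public
    using () renaming (_≈_ to _≈ₜ_)

{-# OPTIONS --safe #-}

-- We look for functionals that every reduction preserves and that read
-- off the coefficients of setTo-t p when all terms of p are irreducible.
--
-- Setting β = 1 and x_ij = - (1 + X + X² + ...), X = w_j / w_i, solves the
-- reduction relation.  A monomial m thereby becomes, up to sign, the generating
-- function of the flows on its edges.  A flow is recorded by the amounts s g
-- passing from the vertices ≤ g to those > g, and is weighted by a function of the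
-- net outflows s g ∸ s (g - 1): the truncated subtraction forgets how much is
-- absorbed at the sinks.  If m is irreducible, every vertex is a source or a sink,
-- so the weighted sum depends only on the multiset of sources of m, that is, on
-- the image of m under x_ij ↦ t_i; and suitable weights single out one such
-- multiset.  Weights of finite support make all sums finite.

module Submission where

open import Defs
open import Data.Fin.Base as Fin using (Fin; toℕ)
import Data.Fin.Properties as Fin
open import Data.List.Base
  using (List; []; _∷_; _++_; map; mapMaybe; concatMap; foldl; length)
open import Data.List.Membership.Propositional using (_∈_; find)
open import Data.List.Membership.Propositional.Properties using (∈-∃++; ∈-allFin; ∈-map⁺)
open import Data.List.Properties using (length-map)
open import Data.List.Relation.Binary.Permutation.Propositional as Perm
  using (_↭_; ↭-refl; ↭-sym; ↭-trans; ↭-prep; ↭-swap)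
import Data.List.Relation.Binary.Permutation.Propositional.Properties as Perm
open import Data.List.Relation.Unary.All as All using (All; []; _∷_)
import Data.List.Relation.Unary.All.Properties as All
open import Data.List.Relation.Unary.Any using (here; there; any?)
import Data.List.Relation.Unary.Any.Properties as Any
import Data.List.Sort.InsertionSort.Properties as InsertionSort
open import Data.Nat.Base as ℕ using (ℕ; zero; suc; pred; z≤n; s≤s; _∸_)
open import Data.Nat.GeneralisedArithmetic using (fold; fold-+)
import Data.Nat.Properties as ℕ
import Data.Nat.Solver as ℕ
open import Data.Product.Base using (_×_; _,_; proj₁; proj₂; ∃-syntax)
open import Data.Rational.Base using (ℚ; 0ℚ; 1ℚ; _+_; _-_; _*_; -_)
import Data.Rational.Properties as ℚ
open import Data.Rational.Solver using (module +-*-Solver)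
open import Data.Sum.Base using (_⊎_; inj₁; inj₂)
open import Data.Unit.Base using (tt)
open import Function.Base using (_∘_; const)
open import Relation.Binary.Construct.Closure.ReflexiveTransitive using (Star; ε; _◅_)
open import Relation.Binary.Definitions using (DecidableEquality)
open import Relation.Binary.PropositionalEquality
  using (_≡_; _≢_; _≗_; refl; sym; trans; cong; cong₂; cong-app; subst; module ≡-Reasoning)
open import Relation.Nullary using (¬_; Dec; yes; no; ¬?; contradiction)
open import Relation.Nullary.Decidable using (_×-dec_; decidable-stable)

-- Finite signed sums and products

-- The minus sign comes from x_ij = - (1 + X + X² + ...): each edge contributes one signed sum, so a
-- monomial with one edge fewer enters with the opposite sign.
∑⁻ : ℕ → (ℕ → ℚ) → ℚ
∑⁻ zero    f = 0ℚ
∑⁻ (suc n) f = ∑⁻ n (f ∘ suc) - f 0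

∑⁻-cong : ∀ n {f g} → (∀ c → f c ≡ g c) → ∑⁻ n f ≡ ∑⁻ n g
∑⁻-cong zero    f≗g = refl
∑⁻-cong (suc n) f≗g = cong₂ _-_ (∑⁻-cong n (f≗g ∘ suc)) (f≗g 0)

∑⁻-zero : ∀ n {f} → (∀ c → f c ≡ 0ℚ) → ∑⁻ n f ≡ 0ℚ
∑⁻-zero zero    f≗0 = refl
∑⁻-zero (suc n) f≗0 = cong₂ _-_ (∑⁻-zero n (f≗0 ∘ suc)) (f≗0 0)

∑⁻-+ : ∀ n f g → ∑⁻ n (λ c → f c + g c) ≡ ∑⁻ n f + ∑⁻ n g
∑⁻-+ zero    f g = refl
∑⁻-+ (suc n) f g = trans (cong (_- (f 0 + g 0)) (∑⁻-+ n (f ∘ suc) (g ∘ suc)))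
  (solve 4 (λ F G a b → (F :+ G) :- (a :+ b) := (F :- a) :+ (G :- b)) refl
     (∑⁻ n (f ∘ suc)) (∑⁻ n (g ∘ suc)) (f 0) (g 0))
  where open +-*-Solver

∑⁻-- : ∀ n f g → ∑⁻ n (λ c → f c - g c) ≡ ∑⁻ n f - ∑⁻ n g
∑⁻-- zero    f g = refl
∑⁻-- (suc n) f g = trans (cong (_- (f 0 - g 0)) (∑⁻-- n (f ∘ suc) (g ∘ suc)))
  (solve 4 (λ F G a b → (F :- G) :- (a :- b) := (F :- a) :- (G :- b)) refl
     (∑⁻ n (f ∘ suc)) (∑⁻ n (g ∘ suc)) (f 0) (g 0))
  where open +-*-Solver

∑⁻-*ˡ : ∀ n q f → ∑⁻ n (λ c → q * f c) ≡ q * ∑⁻ n f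
∑⁻-*ˡ zero    q f = sym (ℚ.*-zeroʳ q)
∑⁻-*ˡ (suc n) q f = trans (cong (_- (q * f 0)) (∑⁻-*ˡ n q (f ∘ suc)))
  (solve 3 (λ q F a → q :* F :- q :* a := q :* (F :- a)) refl q (∑⁻ n (f ∘ suc)) (f 0))
  where open +-*-Solver

∑⁻-*ʳ : ∀ n q f → ∑⁻ n (λ c → f c * q) ≡ ∑⁻ n f * q
∑⁻-*ʳ n q f = trans (∑⁻-cong n (λ c → ℚ.*-comm (f c) q))
  (trans (∑⁻-*ˡ n q f) (ℚ.*-comm q (∑⁻ n f)))

∑⁻-swap : ∀ m n (f : ℕ → ℕ → ℚ) →
  ∑⁻ m (λ a → ∑⁻ n (f a)) ≡ ∑⁻ n (λ b → ∑⁻ m (λ a → f a b))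
∑⁻-swap zero    n f = sym (∑⁻-zero n (λ _ → refl))
∑⁻-swap (suc m) n f = trans (cong (_- ∑⁻ n (f 0)) (∑⁻-swap m n (f ∘ suc)))
  (sym (∑⁻-- n (λ b → ∑⁻ m (λ a → f (suc a) b)) (f 0)))

∑⁻-extend : ∀ {m n} f → m ℕ.≤ n → (∀ c → m ℕ.≤ c → f c ≡ 0ℚ) → ∑⁻ n f ≡ ∑⁻ m f
∑⁻-extend {n = n} f z≤n    f≡0 = ∑⁻-zero n (λ c → f≡0 c z≤n)
∑⁻-extend f (s≤s m≤n) f≡0 =
  cong (_- f 0) (∑⁻-extend (f ∘ suc) m≤n (λ c m≤c → f≡0 (suc c) (s≤s m≤c)))

-- Sort the pairs by their minimum `c`. The two inner sums cover `a ≥ b = c` and `b ≥ a = c`; both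
-- include the diagonal, and the lone `φ c c`, bearing one sign instead of two, removes the
-- repetition. The inner bound `p` stays fixed while `n` decreases in the induction.
∑⁻-min : ∀ {n p} → n ℕ.≤ p → (φ : ℕ → ℕ → ℚ) →
  (∀ a b → n ℕ.≤ a → φ a b ≡ 0ℚ) → (∀ a b → n ℕ.≤ b → φ a b ≡ 0ℚ) →
  ∑⁻ n (λ a → ∑⁻ n (φ a)) ≡
  ∑⁻ n (λ c → ∑⁻ p (λ a → φ (c ℕ.+ a) c) + ∑⁻ p (λ b → φ c (c ℕ.+ b)) + φ c c)
∑⁻-min z≤n φ _ _ = refl
∑⁻-min {suc n} {suc p} (s≤s n≤p) φ φ≡0ˡ φ≡0ʳ = begin
    ∑⁻ n (λ a → ∑⁻ n (φ (suc a) ∘ suc) - φ (suc a) 0) - (∑⁻ n (φ 0 ∘ suc) - φ 0 0)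
  ≡⟨ cong (_- (∑⁻ n (φ 0 ∘ suc) - φ 0 0)) (∑⁻-- n _ _) ⟩
    X - ∑⁻ n (λ a → φ (suc a) 0) - (∑⁻ n (φ 0 ∘ suc) - φ 0 0)
  -- The pairs with minimum 0 form a row and a column that share the corner `φ 0 0`.
  ≡⟨ solve 4 (λ x a b o → (x :- a) :- (b :- o) := x :- ((a :- o) :+ (b :- o) :+ o)) refl
       X (∑⁻ n (λ a → φ (suc a) 0)) (∑⁻ n (φ 0 ∘ suc)) (φ 0 0) ⟩
    X - (∑⁻ n (λ a → φ (suc a) 0) - φ 0 0 + (∑⁻ n (φ 0 ∘ suc) - φ 0 0) + φ 0 0)
  ≡⟨ cong₂ (λ y z → X - (y + z + φ 0 0))
       (∑⁻-extend (λ a → φ a 0) (s≤s n≤p) (λ a → φ≡0ˡ a 0))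
       (∑⁻-extend (φ 0) (s≤s n≤p) (φ≡0ʳ 0)) ⟨
    X - (∑⁻ (suc p) (λ a → φ a 0) + ∑⁻ (suc p) (φ 0) + φ 0 0)
  ≡⟨ cong (_- (∑⁻ (suc p) (λ a → φ a 0) + ∑⁻ (suc p) (φ 0) + φ 0 0))
       (∑⁻-min (ℕ.m≤n⇒m≤1+n n≤p) (λ a b → φ (suc a) (suc b))
         (λ a b n≤a → φ≡0ˡ (suc a) (suc b) (s≤s n≤a))
         (λ a b n≤b → φ≡0ʳ (suc a) (suc b) (s≤s n≤b))) ⟩
    _ ∎
  where
  open ≡-Reasoning
  open +-*-Solver
  X = ∑⁻ n (λ a → ∑⁻ n (φ (suc a) ∘ suc))

-- Flows along the edges of a monomial

-- The Kronecker symbol, with values in ℕ so that it can also count iterations of an operator.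
δ : ℕ → ℕ → ℕ
δ zero    zero    = 1
δ zero    (suc g) = 0
δ (suc i) zero    = 0
δ (suc i) (suc g) = δ i g

-- The indicator function of i ≤ g < j.
χ : ℕ → ℕ → ℕ → ℕ
χ i       zero    g       = 0
χ zero    (suc j) zero    = 1
χ zero    (suc j) (suc g) = χ zero j g
χ (suc i) (suc j) zero    = 0
χ (suc i) (suc j) (suc g) = χ i j g

-- The flow past the preceding vertex; the value at 0 says that nothing enters vertex 0 from the
-- left.
shift : (ℕ → ℕ) → ℕ → ℕ
shift s zero    = 0
shift s (suc g) = s g

χ-empty : ∀ i g → χ i i g ≡ 0
χ-empty zero    g       = refl
χ-empty (suc i) zero    = refl
χ-empty (suc i) (suc g) = χ-empty i g

χ-left : ∀ {i j} → i ℕ.< j → χ i j i ≡ 1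
χ-left {zero}  (s≤s _)   = refl
χ-left {suc i} (s≤s i<j) = χ-left i<j

χ-+ : ∀ {i j k} → i ℕ.≤ j → j ℕ.≤ k → ∀ g → χ i k g ≡ χ i j g ℕ.+ χ j k g
χ-+ {zero}          z≤n       z≤n       g       = refl
χ-+ {zero}          z≤n       (s≤s j≤k) zero    = refl
χ-+ {zero}          z≤n       (s≤s j≤k) (suc g) = χ-+ z≤n j≤k g
χ-+ {suc i}         (s≤s i≤j) (s≤s j≤k) zero    = refl
χ-+ {suc i}         (s≤s i≤j) (s≤s j≤k) (suc g) = χ-+ i≤j j≤k g

-- A unit of flow leaves `i` and is absorbed at `j`. Each delta sits on the side that avoids
-- subtraction in ℕ.
χ-conservation : ∀ {i j} → i ℕ.≤ j → ∀ g → χ i j g ℕ.+ δ j g ≡ shift (χ i j) g ℕ.+ δ i g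
χ-conservation {zero}  {zero}        z≤n       zero          = refl
χ-conservation {zero}  {zero}        z≤n       (suc g)       = cong (ℕ._+ 0) (sym (χ-empty zero g))
χ-conservation {zero}  {suc j}       z≤n       zero          = refl
χ-conservation {zero}  {suc zero}    z≤n       (suc zero)    = refl
χ-conservation {zero}  {suc (suc j)} z≤n       (suc zero)    = refl
χ-conservation {zero}  {suc j}       z≤n       (suc (suc g)) = χ-conservation (z≤n {j}) (suc g)
χ-conservation {suc i} {suc j}       (s≤s i≤j) zero          = refl
χ-conservation {suc i} {suc j}       (s≤s i≤j) (suc zero)    = χ-conservation i≤j zero
χ-conservation {suc i} {suc j}       (s≤s i≤j) (suc (suc g)) = χ-conservation i≤j (suc g)


δ-refl : ∀ i → δ i i ≡ 1
δ-refl zero    = refl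
δ-refl (suc i) = δ-refl i

δ-≢ : ∀ {i g} → i ≢ g → δ i g ≡ 0
δ-≢ {zero}  {zero}  i≢g = contradiction refl i≢g
δ-≢ {zero}  {suc g} i≢g = refl
δ-≢ {suc i} {zero}  i≢g = refl
δ-≢ {suc i} {suc g} i≢g = δ-≢ (i≢g ∘ cong suc)

crosses : ∀ {n} → Edge n → ℕ → ℕ
crosses e = χ (toℕ (src e)) (toℕ (tgt e))

src<pred : ∀ {n} (e : Edge n) → toℕ (src e) ℕ.< pred n
src<pred e = ℕ.≤-trans (src<tgt e) (Fin.toℕ≤pred[n] (tgt e))

module Flows {n : ℕ} (N : ℕ) (ψ : (ℕ → ℕ) → ℚ)
  (ψ-cong : ∀ {s s′} → s ≗ s′ → ψ s ≡ ψ s′)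
  (ψ-bounded : ∀ {s g} → g ℕ.< pred n → N ℕ.≤ s g → ψ s ≡ 0ℚ) where

  -- The argument `s` accumulates the flow already chosen on earlier edges. Cutting each geometric
  -- series off at `N` loses nothing, because `ψ` vanishes on larger flows.
  S : Monomial (Edge n) → (ℕ → ℕ) → ℚ
  S []      s = ψ s
  S (e ∷ m) s = ∑⁻ N λ c → S m (λ g → s g ℕ.+ c ℕ.* crosses e g)

  S-cong : ∀ m {s s′} → s ≗ s′ → S m s ≡ S m s′
  S-cong []      s≗s′ = ψ-cong s≗s′
  S-cong (e ∷ m) s≗s′ = ∑⁻-cong N λ c → S-cong m λ g → cong (ℕ._+ c ℕ.* crosses e g) (s≗s′ g)

  -- Further edges only add to the flow, so an excess past `g` persists until `ψ` is evaluated.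
  S-bounded : ∀ m {s g} → g ℕ.< pred n → N ℕ.≤ s g → S m s ≡ 0ℚ
  S-bounded []      g<k N≤sg = ψ-bounded g<k N≤sg
  S-bounded (e ∷ m) g<k N≤sg = ∑⁻-zero N λ c → S-bounded m g<k (ℕ.≤-trans N≤sg (ℕ.m≤m+n _ _))

  S-resp-↭ : ∀ {m m′} → m ↭ m′ → ∀ s → S m s ≡ S m′ s
  S-resp-↭ Perm.refl       s = refl
  S-resp-↭ (Perm.prep e m↭m′) s = ∑⁻-cong N λ c → S-resp-↭ m↭m′ _
  S-resp-↭ (Perm.trans p q) s = trans (S-resp-↭ p s) (S-resp-↭ q s)
  S-resp-↭ (Perm.swap {xs = m} {ys = m′} e f m↭m′) s = trans (∑⁻-swap N N _)
    (∑⁻-cong N λ c → ∑⁻-cong N λ d → trans (S-resp-↭ m↭m′ _) (S-cong m′ λ g →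
      solve 3 (λ a b c → (a :+ b) :+ c := (a :+ c) :+ b) refl
        (s g) (d ℕ.* crosses e g) (c ℕ.* crosses f g)))
    where open ℕ.+-*-Solver

  -- Two flows a and b along i → j and j → k share the flow min(a,b) along
  -- i → k; what is left over is a flow along only one of the two edges.
  S-reduce : ∀ {i j k : Fin n} (i<j : i Fin.< j) (j<k : j Fin.< k) r s →
    let i<k = Fin.<-trans i<j j<k in
    S (x i<j ∷ x j<k ∷ r) s ≡
    S (x i<k ∷ x i<j ∷ r) s + S (x i<k ∷ x j<k ∷ r) s + S (x i<k ∷ r) s
  S-reduce {i} {j} {k} i<j j<k r s = begin
      ∑⁻ N (λ a → ∑⁻ N (φ a))
    ≡⟨ ∑⁻-min ℕ.≤-refl φ
         (λ a b N≤a → S-bounded r (src<pred (x i<j)) (left a b N≤a))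
         (λ a b N≤b → S-bounded r (src<pred (x j<k)) (right a b N≤b)) ⟩
      ∑⁻ N (λ c → ∑⁻ N (λ a → φ (c ℕ.+ a) c) + ∑⁻ N (λ b → φ c (c ℕ.+ b)) + φ c c)
    ≡⟨ trans (∑⁻-+ N _ _) (cong (_+ ∑⁻ N (λ c → φ c c)) (∑⁻-+ N _ _)) ⟩
      ∑⁻ N (λ c → ∑⁻ N (λ a → φ (c ℕ.+ a) c)) + ∑⁻ N (λ c → ∑⁻ N (λ b → φ c (c ℕ.+ b)))
        + ∑⁻ N (λ c → φ c c)
    ≡⟨ cong₂ _+_ (cong₂ _+_
         (∑⁻-cong N λ c → ∑⁻-cong N λ a → S-cong r λ g →
           trans (solve 5 (λ s c a y z → s :+ (c :+ a) :* y :+ c :* z := s :+ c :* (y :+ z) :+ a :* y)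
                   refl (s g) c a (y g) (z g))
             (cong (λ v → s g ℕ.+ c ℕ.* v ℕ.+ a ℕ.* y g) (y+z g)))
         (∑⁻-cong N λ c → ∑⁻-cong N λ b → S-cong r λ g →
           trans (solve 5 (λ s c b y z → s :+ c :* y :+ (c :+ b) :* z := s :+ c :* (y :+ z) :+ b :* z)
                   refl (s g) c b (y g) (z g))
             (cong (λ v → s g ℕ.+ c ℕ.* v ℕ.+ b ℕ.* z g) (y+z g))))
         (∑⁻-cong N λ c → S-cong r λ g →
           trans (solve 4 (λ s c y z → s :+ c :* y :+ c :* z := s :+ c :* (y :+ z))
                   refl (s g) c (y g) (z g))
             (cong (λ v → s g ℕ.+ c ℕ.* v) (y+z g))) ⟩
      _ ∎
    where
    open ≡-Reasoning
    open ℕ.+-*-Solver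
    y z : ℕ → ℕ
    y = crosses (x i<j)
    z = crosses (x j<k)
    y+z : ∀ g → y g ℕ.+ z g ≡ crosses (x (Fin.<-trans i<j j<k)) g
    y+z g = sym (χ-+ (ℕ.<⇒≤ i<j) (ℕ.<⇒≤ j<k) g)
    φ : ℕ → ℕ → ℚ
    φ a b = S r (λ g → s g ℕ.+ a ℕ.* y g ℕ.+ b ℕ.* z g)
    -- An edge crosses the gap just after its source, so its flow alone already forces a total of at
    -- least `N` there.
    left : ∀ a b → N ℕ.≤ a → N ℕ.≤ s (toℕ i) ℕ.+ a ℕ.* y (toℕ i) ℕ.+ b ℕ.* z (toℕ i)
    left a b N≤a rewrite χ-left i<j | ℕ.*-identityʳ a =
      ℕ.≤-trans N≤a (ℕ.≤-trans (ℕ.m≤n+m a (s (toℕ i))) (ℕ.m≤m+n _ _))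
    right : ∀ a b → N ℕ.≤ b → N ℕ.≤ s (toℕ j) ℕ.+ a ℕ.* y (toℕ j) ℕ.+ b ℕ.* z (toℕ j)
    right a b N≤b rewrite χ-left j<k | ℕ.*-identityʳ b = ℕ.≤-trans N≤b (ℕ.m≤n+m b _)

-- Weights dual to the out-degrees

∏ : ℕ → (ℕ → ℚ) → ℚ
∏ zero    f = 1ℚ
∏ (suc k) f = f 0 * ∏ k (f ∘ suc)

∏-cong : ∀ k {f g} → (∀ {i} → i ℕ.< k → f i ≡ g i) → ∏ k f ≡ ∏ k g
∏-cong zero    f≗g = refl
∏-cong (suc k) f≗g = cong₂ _*_ (f≗g (s≤s z≤n)) (∏-cong k (f≗g ∘ s≤s))

∏-one : ∀ k {f} → (∀ {i} → i ℕ.< k → f i ≡ 1ℚ) → ∏ k f ≡ 1ℚ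
∏-one zero    f≗1 = refl
∏-one (suc k) f≗1 = cong₂ _*_ (f≗1 (s≤s z≤n)) (∏-one k (f≗1 ∘ s≤s))

∏-zero : ∀ {k i} f → i ℕ.< k → f i ≡ 0ℚ → ∏ k f ≡ 0ℚ
∏-zero {suc k} {zero}  f _         f0≡0 =
  trans (cong (_* ∏ k (f ∘ suc)) f0≡0) (ℚ.*-zeroˡ (∏ k (f ∘ suc)))
∏-zero {suc k} {suc i} f (s≤s i<k) fi≡0 =
  trans (cong (f 0 *_) (∏-zero (f ∘ suc) i<k fi≡0)) (ℚ.*-zeroʳ (f 0))

-- Finite differences and their inverse

∇ : (ℕ → ℚ) → ℕ → ℚ
∇ f a = f (suc a) - f a

∑⁻-telescope : ∀ n f → ∑⁻ n (∇ f) ≡ f 0 - f n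
∑⁻-telescope zero    f = sym (ℚ.+-inverseʳ (f 0))
∑⁻-telescope (suc n) f = trans (cong (_- ∇ f 0) (∑⁻-telescope n (f ∘ suc)))
  (solve 3 (λ a b c → (b :- c) :- (b :- a) := a :- c) refl (f 0) (f 1) (f (suc n)))
  where open +-*-Solver

fold-suc : ∀ {A : Set} (f : A → A) n {z} → f (fold z f n) ≡ fold (f z) f n
fold-suc f zero    = refl
fold-suc f (suc n) = cong f (fold-suc f n)

VanishesFrom : ℕ → (ℕ → ℚ) → Set
VanishesFrom N f = ∀ {a} → N ℕ.≤ a → f a ≡ 0ℚ

∇-vanishes : ∀ {N f} → VanishesFrom N f → VanishesFrom N (∇ f)
∇-vanishes f≡0 N≤a = cong₂ _-_ (f≡0 (ℕ.m≤n⇒m≤1+n N≤a)) (f≡0 N≤a)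

∇^-vanishes : ∀ {N f} m → VanishesFrom N f → VanishesFrom N (fold f ∇ m)
∇^-vanishes zero    f≡0 = f≡0
∇^-vanishes (suc m) f≡0 = ∇-vanishes (∇^-vanishes m f≡0)

module _ (N : ℕ) where

  -- On functions vanishing from `N` this is the negated tail sum, which inverts `∇` by telescoping.
  -- It is the effect that one more edge leaving a vertex has on the weight there.
  U : (ℕ → ℚ) → ℕ → ℚ
  U f a = ∑⁻ N λ c → f (a ℕ.+ c)

  U-cong : ∀ {f g} → f ≗ g → U f ≗ U g
  U-cong f≗g a = ∑⁻-cong N λ c → f≗g (a ℕ.+ c)

  U-∇ : ∀ {f} → VanishesFrom N f → U (∇ f) ≗ f
  U-∇ {f} f≡0 a = begin
      ∑⁻ N (λ c → f (suc (a ℕ.+ c)) - f (a ℕ.+ c))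
    ≡⟨ ∑⁻-cong N (λ c → cong (λ v → f v - f (a ℕ.+ c)) (ℕ.+-suc a c)) ⟨
      ∑⁻ N (∇ (f ∘ (a ℕ.+_)))
    ≡⟨ ∑⁻-telescope N (f ∘ (a ℕ.+_)) ⟩
      f (a ℕ.+ 0) - f (a ℕ.+ N)
    ≡⟨ cong₂ (λ v w → f v - w) (ℕ.+-identityʳ a) (f≡0 (ℕ.m≤n+m N a)) ⟩
      f a - 0ℚ
    ≡⟨ ℚ.+-identityʳ (f a) ⟩
      f a ∎
    where open ≡-Reasoning

  U^-∇^ : ∀ d {f} → VanishesFrom N f → fold (fold f ∇ d) U d ≗ f
  U^-∇^ zero        f≡0 a = refl
  -- One difference is moved innermost, onto `f`, so that the induction hypothesis for `∇ f` leaves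
  -- a single `U` to cancel it.
  U^-∇^ (suc d) {f} f≡0 a rewrite fold-suc ∇ d {f} =
    trans (U-cong (U^-∇^ d (∇-vanishes f≡0)) a) (U-∇ f≡0 a)

  -- Only the factor at `j` depends on `c`, so the sum acts on that factor alone, as one application
  -- of `U`.
  ∑⁻-∏ : ∀ {k j} → j ℕ.< k → (F : ℕ → ℕ → ℚ) (o : ℕ → ℕ) →
    ∑⁻ N (λ c → ∏ k (λ g → F g (o g ℕ.+ c ℕ.* δ j g))) ≡ ∏ k (λ g → fold (F g) U (δ j g) (o g))
  ∑⁻-∏ {suc k} {zero} _ F o = begin
      ∑⁻ N (λ c → F 0 (o 0 ℕ.+ c ℕ.* 1) * ∏ k (λ g → F (suc g) (o (suc g) ℕ.+ c ℕ.* 0)))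
    ≡⟨ ∑⁻-cong N (λ c → cong₂ _*_ (cong (λ v → F 0 (o 0 ℕ.+ v)) (ℕ.*-identityʳ c))
         (∏-cong k λ {g} _ → cong (F (suc g))
           (trans (cong (o (suc g) ℕ.+_) (ℕ.*-zeroʳ c)) (ℕ.+-identityʳ _)))) ⟩
      ∑⁻ N (λ c → F 0 (o 0 ℕ.+ c) * ∏ k (λ g → F (suc g) (o (suc g))))
    ≡⟨ ∑⁻-*ʳ N _ _ ⟩
      _ ∎
    where open ≡-Reasoning
  ∑⁻-∏ {suc k} {suc j} (s≤s j<k) F o = begin
      ∑⁻ N (λ c → F 0 (o 0 ℕ.+ c ℕ.* 0) * ∏ k (λ g → F (suc g) (o (suc g) ℕ.+ c ℕ.* δ j g)))
    ≡⟨ ∑⁻-cong N (λ c → cong (_* ∏ k (λ g → F (suc g) (o (suc g) ℕ.+ c ℕ.* δ j g)))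
         (cong (F 0) (trans (cong (o 0 ℕ.+_) (ℕ.*-zeroʳ c)) (ℕ.+-identityʳ _)))) ⟩
      ∑⁻ N (λ c → F 0 (o 0) * ∏ k (λ g → F (suc g) (o (suc g) ℕ.+ c ℕ.* δ j g)))
    ≡⟨ ∑⁻-*ˡ N (F 0 (o 0)) _ ⟩
      F 0 (o 0) * ∑⁻ N (λ c → ∏ k (λ g → F (suc g) (o (suc g) ℕ.+ c ℕ.* δ j g)))
    ≡⟨ cong (F 0 (o 0) *_) (∑⁻-∏ j<k (F ∘ suc) (o ∘ suc)) ⟩
      _ ∎
    where open ≡-Reasoning

-- The binomial coefficient "a choose r".
η : ℕ → ℕ → ℚ
η zero    a       = 1ℚ
η (suc r) zero    = 0ℚ
η (suc r) (suc a) = η (suc r) a + η r a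

-- An `m`-th difference at 0 involves only the values at 0, ..., `m`; this is why truncation beyond
-- them is harmless.
∇^-zero : ∀ m {f} → (∀ {a} → a ℕ.≤ m → f a ≡ 0ℚ) → fold f ∇ m 0 ≡ 0ℚ
∇^-zero zero        f≡0 = f≡0 z≤n
∇^-zero (suc m) {f} f≡0 =
  trans (cong-app (fold-suc ∇ m) 0)
    (∇^-zero m λ a≤m → cong₂ _-_ (f≡0 (s≤s a≤m)) (f≡0 (ℕ.m≤n⇒m≤1+n a≤m)))

∇η : ∀ r a → ∇ (η (suc r)) a ≡ η r a
∇η r a = solve 2 (λ x y → (x :+ y) :- x := y) refl (η (suc r) a) (η r a)
  where open +-*-Solver

∇^-η-≡ : ∀ m {f} → (∀ {a} → a ℕ.≤ m → f a ≡ η m a) → fold f ∇ m 0 ≡ 1ℚ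
∇^-η-≡ zero        f≡η = f≡η z≤n
∇^-η-≡ (suc m) {f} f≡η =
  trans (cong-app (fold-suc ∇ m) 0) (∇^-η-≡ m λ {a} a≤m →
    trans (cong₂ _-_ (f≡η (s≤s a≤m)) (f≡η (ℕ.m≤n⇒m≤1+n a≤m))) (∇η m a))

-- By Pascal's rule each difference lowers `r` by one. If `r` runs out first, a constant is
-- differenced to zero; otherwise a binomial coefficient with positive lower index is evaluated at
-- 0.
∇^-η-≢ : ∀ {m r f} → m ≢ r → (∀ {a} → a ℕ.≤ m → f a ≡ η r a) → fold f ∇ m 0 ≡ 0ℚ
∇^-η-≢ {zero}  {zero}  m≢r f≡η = contradiction refl m≢r
∇^-η-≢ {zero}  {suc r} m≢r f≡η = f≡η z≤n
∇^-η-≢ {suc m} {zero}  {f} m≢r f≡η =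
  trans (cong-app (fold-suc ∇ m) 0)
    (∇^-zero m λ a≤m → cong₂ _-_ (f≡η (s≤s a≤m)) (f≡η (ℕ.m≤n⇒m≤1+n a≤m)))
∇^-η-≢ {suc m} {suc r} {f} m≢r f≡η =
  trans (cong-app (fold-suc ∇ m) 0) (∇^-η-≢ (m≢r ∘ cong suc) λ {a} a≤m →
    trans (cong₂ _-_ (f≡η (s≤s a≤m)) (f≡η (ℕ.m≤n⇒m≤1+n a≤m))) (∇η r a))

-- Finite support is what makes `U` an inverse of `∇` and all flow sums finite.
truncate : ℕ → (ℕ → ℚ) → ℕ → ℚ
truncate D f a with a ℕ.≤? D
... | yes _ = f a
... | no  _ = 0ℚ

truncate-≤ : ∀ {D f a} → a ℕ.≤ D → truncate D f a ≡ f a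
truncate-≤ {D} {f} {a} a≤D with a ℕ.≤? D
... | yes _   = refl
... | no  a≰D = contradiction a≤D a≰D

truncate-vanishes : ∀ {D f} → VanishesFrom (suc D) (truncate D f)
truncate-vanishes {D} {f} {a} D<a with a ℕ.≤? D
... | yes a≤D = contradiction a≤D (ℕ.<⇒≱ D<a)
... | no  _   = refl

-- Since U inverts ∇, these satisfy (Uᵈ (θ D e)) 0 = [ d = e ] for d, e ≤ D: the
-- value is (∇ᴰ⁻ᵈ η_{D-e}) 0, unaffected by the truncation.
θ : ℕ → ℕ → ℕ → ℚ
θ D e = fold (truncate D (η (D ∸ e))) ∇ D

θ-vanishes : ∀ D e → VanishesFrom (suc D) (θ D e)
θ-vanishes D e = ∇^-vanishes D (truncate-vanishes {D})

module _ {D N d e : ℕ} (D<N : D ℕ.< N) (d≤D : d ℕ.≤ D) where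

  U^-θ : fold (θ D e) (U N) d ≗ fold (truncate D (η (D ∸ e))) ∇ (D ∸ d)
  U^-θ a = trans (cong (λ f → fold f (U N) d a) eq)
    (U^-∇^ N d (∇^-vanishes (D ∸ d) λ N≤a → truncate-vanishes {D} (ℕ.≤-trans D<N N≤a)) a)
    where
    h = truncate D (η (D ∸ e))
    -- The outermost `d` of the `D` differences are split off, to be cancelled by the `d` copies of
    -- `U`.
    eq : fold h ∇ D ≡ fold (fold h ∇ (D ∸ d)) ∇ d
    eq = trans (cong (fold h ∇) (sym (ℕ.m+[n∸m]≡n d≤D))) (fold-+ h ∇ d)

  U^-θ-≡ : d ≡ e → fold (θ D e) (U N) d 0 ≡ 1ℚ
  U^-θ-≡ refl = trans (U^-θ 0) (∇^-η-≡ (D ∸ d) λ a≤ → truncate-≤ (ℕ.≤-trans a≤ (ℕ.m∸n≤m D d)))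

  U^-θ-≢ : e ℕ.≤ D → d ≢ e → fold (θ D e) (U N) d 0 ≡ 0ℚ
  U^-θ-≢ e≤D d≢e = trans (U^-θ 0) (∇^-η-≢ (d≢e ∘ ℕ.∸-cancelˡ-≡ d≤D e≤D)
    λ a≤ → truncate-≤ (ℕ.≤-trans a≤ (ℕ.m∸n≤m D d)))

-- Multisets and their multiplicities

multiplicity : ∀ {k} → ℕ → List (Fin k) → ℕ
multiplicity g []      = 0
multiplicity g (i ∷ m) = δ (toℕ i) g ℕ.+ multiplicity g m

δ≤1 : ∀ i g → δ i g ℕ.≤ 1
δ≤1 zero    zero    = ℕ.≤-refl
δ≤1 zero    (suc g) = z≤n
δ≤1 (suc i) zero    = z≤n
δ≤1 (suc i) (suc g) = δ≤1 i g

multiplicity≤length : ∀ {k} g (m : List (Fin k)) → multiplicity g m ℕ.≤ length m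
multiplicity≤length g []      = z≤n
multiplicity≤length g (i ∷ m) = ℕ.+-mono-≤ (δ≤1 (toℕ i) g) (multiplicity≤length g m)

multiplicity-resp-↭ : ∀ {k} g {m m′ : List (Fin k)} → m ↭ m′ → multiplicity g m ≡ multiplicity g m′
multiplicity-resp-↭ g Perm.refl        = refl
multiplicity-resp-↭ g (Perm.prep i p)  = cong (δ (toℕ i) g ℕ.+_) (multiplicity-resp-↭ g p)
multiplicity-resp-↭ g (Perm.trans p q) = trans (multiplicity-resp-↭ g p) (multiplicity-resp-↭ g q)
multiplicity-resp-↭ g (Perm.swap {ys = m′} i j p) =
  trans (cong (λ v → δ (toℕ i) g ℕ.+ (δ (toℕ j) g ℕ.+ v)) (multiplicity-resp-↭ g p))
    (solve 3 (λ a b c → a :+ (b :+ c) := b :+ (a :+ c)) refl (δ (toℕ i) g) (δ (toℕ j) g)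
      (multiplicity g m′))
  where open ℕ.+-*-Solver

multiplicity-∈ : ∀ {k} (i : Fin k) m → multiplicity (toℕ i) m ≢ 0 → i ∈ m
multiplicity-∈ i []      ≢0 = contradiction refl ≢0
multiplicity-∈ i (j ∷ m) ≢0 with i Fin.≟ j
... | yes i≡j = here i≡j
... | no  i≢j = there (multiplicity-∈ i m λ ≡0 → ≢0
  (cong₂ ℕ._+_ (δ-≢ (i≢j ∘ sym ∘ Fin.toℕ-injective)) ≡0))

multiplicity-head : ∀ {k} (i : Fin k) m → multiplicity (toℕ i) (i ∷ m) ≢ 0
multiplicity-head i m rewrite δ-refl (toℕ i) = λ ()

-- The head of `m` has nonzero multiplicity in `m′`, hence occurs there, and can be cancelled from
-- both.
multiplicity⇒↭ : ∀ {k} (m m′ : List (Fin k)) →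
  (∀ {g} → g ℕ.< k → multiplicity g m ≡ multiplicity g m′) → m ↭ m′
multiplicity⇒↭ []      []       eq = Perm.refl
multiplicity⇒↭ []      (i ∷ m′) eq = contradiction (sym (eq (Fin.toℕ<n i))) (multiplicity-head i m′)
multiplicity⇒↭ (i ∷ m) m′       eq
  with ys , zs , refl ← ∈-∃++ (multiplicity-∈ i m′
         (multiplicity-head i m ∘ trans (eq (Fin.toℕ<n i)))) =
  ↭-trans (↭-prep i (multiplicity⇒↭ m (ys ++ zs) λ {g} g<k →
      ℕ.+-cancelˡ-≡ (δ (toℕ i) g) _ _
        (trans (eq g<k) (multiplicity-resp-↭ g (Perm.shift i ys zs)))))
    (↭-sym (Perm.shift i ys zs))

-- The flow past `g` is at most the sum of the truncated net outflows at 0, ..., `g`, so a large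
-- flow needs a large outflow somewhere.
∸-overflow : ∀ B (s : ℕ → ℕ) g →
  (∃[ i ] i ℕ.≤ g × B ℕ.≤ s i ∸ shift s i) ⊎ s g ℕ.≤ suc g ℕ.* B
∸-overflow B s zero with B ℕ.≤? s 0
... | yes B≤s0 = inj₁ (0 , z≤n , B≤s0)
... | no  B≰s0 = inj₂ (ℕ.≤-trans (ℕ.≰⇒≥ B≰s0) (ℕ.m≤m+n B 0))
∸-overflow B s (suc g) with ∸-overflow B s g | B ℕ.≤? s (suc g) ∸ s g
... | inj₁ (i , i≤g , B≤) | _      = inj₁ (i , ℕ.m≤n⇒m≤1+n i≤g , B≤)
... | inj₂ sg≤            | yes B≤ = inj₁ (suc g , ℕ.≤-refl , B≤)
... | inj₂ sg≤            | no  B≰ = inj₂ (begin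
      s (suc g)                   ≤⟨ ℕ.m≤n+m∸n (s (suc g)) (s g) ⟩
      s g ℕ.+ (s (suc g) ∸ s g)   ≤⟨ ℕ.+-mono-≤ sg≤ (ℕ.≰⇒≥ B≰) ⟩
      suc g ℕ.* B ℕ.+ B           ≡⟨ ℕ.+-comm (suc g ℕ.* B) B ⟩
      suc (suc g) ℕ.* B           ∎)
  where open ℕ.≤-Reasoning

-- Sources, sinks and net outflows

toℕ-lower : ∀ {m k} (i : Fin m) .(i<k : toℕ i ℕ.< k) → toℕ (Fin.lower i i<k) ≡ toℕ i
toℕ-lower {k = suc k} Fin.zero    i<k = refl
toℕ-lower {k = suc k} (Fin.suc i) i<k = cong suc (toℕ-lower i (ℕ.s≤s⁻¹ i<k))

toℕ-t : ∀ {n} (e : Edge n) → toℕ (t e) ≡ toℕ (src e)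
toℕ-t (edge {i} {j} i<j) = toℕ-lower i _

shift-+-* : ∀ s c r g → shift (λ g → s g ℕ.+ c ℕ.* r g) g ≡ shift s g ℕ.+ c ℕ.* shift r g
shift-+-* s c r zero    = sym (ℕ.*-zeroʳ c)
shift-+-* s c r (suc g) = refl

-- At a vertex g where all further edges of m are outgoing, the flow s past g
-- exceeds the flow past g - 1 by the outflow o; where they are all incoming, it
-- does not exceed it.  Either way s g ∸ shift s g is the outflow.
Balanced : ∀ {n} → Monomial (Edge n) → (s o : ℕ → ℕ) → ℕ → Set
Balanced m s o g =
    All (λ e → toℕ (tgt e) ≢ g) m × s g ≡ shift s g ℕ.+ o g
  ⊎ All (λ e → toℕ (src e) ≢ g) m × o g ≡ 0 × s g ℕ.≤ shift s g

Balanced⇒∸ : ∀ {n m s o g} → Balanced {n} m s o g → s g ∸ shift s g ≡ o g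
Balanced⇒∸ {s = s} {o} {g} (inj₁ (_ , s≡))        rewrite s≡  = ℕ.m+n∸m≡n (shift s g) (o g)
Balanced⇒∸                 (inj₂ (_ , o≡0 , s≤)) rewrite o≡0 = ℕ.m≤n⇒m∸n≡0 s≤

-- By conservation, extra flow along `e` raises the step at `g` by exactly the new outflow if `e`
-- does not end at `g`, and cannot raise it if `e` does not start at `g`.
Balanced-∷ : ∀ {n} {e : Edge n} {m s o g} c → Balanced (e ∷ m) s o g →
  Balanced m (λ g → s g ℕ.+ c ℕ.* crosses e g) (λ g → o g ℕ.+ c ℕ.* δ (toℕ (src e)) g) g
Balanced-∷ {e = e} {s = s} {o} {g} c bal
  with conservation ← χ-conservation (ℕ.<⇒≤ (src<tgt e)) g
  with bal
... | inj₁ (tgt≢g ∷ m≢ , s≡) = inj₁ (m≢ , (begin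
      s g ℕ.+ c ℕ.* crosses e g
    ≡⟨ cong₂ (λ v w → v ℕ.+ c ℕ.* w) s≡ crosses≡ ⟩
      shift s g ℕ.+ o g ℕ.+ c ℕ.* (shift (crosses e) g ℕ.+ δ (toℕ (src e)) g)
    ≡⟨ solve 5 (λ s o c r d → s :+ o :+ c :* (r :+ d) := s :+ c :* r :+ (o :+ c :* d)) refl
         (shift s g) (o g) c (shift (crosses e) g) (δ (toℕ (src e)) g) ⟩
      shift s g ℕ.+ c ℕ.* shift (crosses e) g ℕ.+ (o g ℕ.+ c ℕ.* δ (toℕ (src e)) g)
    ≡⟨ cong (ℕ._+ (o g ℕ.+ c ℕ.* δ (toℕ (src e)) g)) (shift-+-* s c (crosses e) g) ⟨
      _ ∎))
  where
  open ≡-Reasoning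
  open ℕ.+-*-Solver
  crosses≡ : crosses e g ≡ shift (crosses e) g ℕ.+ δ (toℕ (src e)) g
  crosses≡ = trans (sym (ℕ.+-identityʳ _))
    (trans (cong (crosses e g ℕ.+_) (sym (δ-≢ tgt≢g))) conservation)
... | inj₂ (src≢g ∷ m≢ , o≡0 , s≤) = inj₂ (m≢ ,
    trans (cong₂ (λ v w → v ℕ.+ c ℕ.* w) o≡0 (δ-≢ src≢g)) (ℕ.*-zeroʳ c) , (begin
      s g ℕ.+ c ℕ.* crosses e g
    ≤⟨ ℕ.+-mono-≤ s≤ (ℕ.*-monoʳ-≤ c crosses≤) ⟩
      shift s g ℕ.+ c ℕ.* shift (crosses e) g
    ≡⟨ shift-+-* s c (crosses e) g ⟨
      _ ∎))
  where
  open ℕ.≤-Reasoning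
  crosses≤ : crosses e g ℕ.≤ shift (crosses e) g
  crosses≤ = begin
      crosses e g                                     ≤⟨ ℕ.m≤m+n _ _ ⟩
      crosses e g ℕ.+ δ (toℕ (tgt e)) g               ≡⟨ conservation ⟩
      shift (crosses e) g ℕ.+ δ (toℕ (src e)) g       ≡⟨ cong (shift (crosses e) g ℕ.+_) (δ-≢ src≢g) ⟩
      shift (crosses e) g ℕ.+ 0                       ≡⟨ ℕ.+-identityʳ _ ⟩
      shift (crosses e) g                             ∎

Irreducible⇒Balanced : ∀ {n} {m : Monomial (Edge n)} → Irreducible m →
  ∀ g → Balanced m (const 0) (const 0) g
Irreducible⇒Balanced {m = m} irr g with any? (λ e → toℕ (src e) ℕ.≟ g) m
-- Irreducibility is used only when some edge starts at `g`: then none may end there.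
... | no  ∄src = inj₂ (All.¬Any⇒All¬ m ∄src , refl , z≤n)
... | yes ∃src with e , e∈m , refl ← find ∃src = inj₁
  (All.tabulate (λ f∈m tgt≡ → irr f∈m e∈m (Fin.toℕ-injective tgt≡)) , shift-0 g)
  where
  shift-0 : ∀ g → 0 ≡ shift (const 0) g ℕ.+ 0
  shift-0 zero    = refl
  shift-0 (suc g) = refl

𝟙[_] : ∀ {A : Set} → Dec A → ℚ
𝟙[ yes _ ] = 1ℚ
𝟙[ no  _ ] = 0ℚ

𝟙-yes : ∀ {A : Set} (a? : Dec A) → A → 𝟙[ a? ] ≡ 1ℚ
𝟙-yes (yes _) a = refl
𝟙-yes (no ¬a) a = contradiction a ¬a

𝟙-no : ∀ {A : Set} (a? : Dec A) → ¬ A → 𝟙[ a? ] ≡ 0ℚ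
𝟙-no (yes a) ¬a = contradiction a ¬a
𝟙-no (no _)  ¬a = refl

-- Values on irreducible monomials

module Evaluation {n : ℕ} (D : ℕ) (target : Monomial (Fin (pred n))) where

  open PolyEquality (Fin._≟_ {pred n}) using (_↭?_)

  private
    k = pred n
    -- By `∸-overflow` with bound `suc D`, a flow whose outflows are all at most `D` is at most k (D
    -- + 1) past each vertex below `k`, which is less than `N`.
    N = suc k ℕ.* suc D

  Θ : ℕ → ℕ → ℚ
  Θ g = θ D (multiplicity g target)

  ψ : (ℕ → ℕ) → ℚ
  ψ s = ∏ k λ g → Θ g (s g ∸ shift s g)

  ψ-cong : ∀ {s s′} → s ≗ s′ → ψ s ≡ ψ s′
  ψ-cong {s} {s′} s≗s′ = ∏-cong k λ {g} _ → cong (Θ g) (cong₂ _∸_ (s≗s′ g) (shift-cong g))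
    where
    shift-cong : shift s ≗ shift s′
    shift-cong zero    = refl
    shift-cong (suc g) = s≗s′ g

  ψ-bounded : ∀ {s g} → g ℕ.< k → N ℕ.≤ s g → ψ s ≡ 0ℚ
  ψ-bounded {s} {g} g<k N≤sg with ∸-overflow (suc D) s g
  ... | inj₁ (i , i≤g , D<) =
    ∏-zero (λ g → Θ g (s g ∸ shift s g)) (ℕ.≤-<-trans i≤g g<k)
      (θ-vanishes D (multiplicity i target) D<)
  ... | inj₂ sg≤ = contradiction
    (ℕ.<-≤-trans (s≤s (ℕ.m≤n+m _ D)) (ℕ.≤-trans N≤sg (ℕ.≤-trans sg≤ (ℕ.*-monoˡ-≤ (suc D) g<k))))
    (ℕ.<-irrefl refl)

  open Flows {n} N ψ ψ-cong ψ-bounded public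

  -- What `S` becomes once all net outflows are known: each edge adds its flow at its source and its
  -- target is forgotten, so a monomial in the t variables suffices.
  outflows : Monomial (Fin k) → (ℕ → ℕ) → ℚ
  outflows []      o = ∏ k λ g → Θ g (o g)
  outflows (i ∷ m) o = ∑⁻ N λ c → outflows m (λ g → o g ℕ.+ c ℕ.* δ (toℕ i) g)

  -- Each edge with source `g` applies `U` once to the weight at `g`.
  outflows-∏ : ∀ m o → outflows m o ≡ ∏ k (λ g → fold (Θ g) (U N) (multiplicity g m) (o g))
  outflows-∏ []      o = refl
  outflows-∏ (i ∷ m) o = trans (∑⁻-cong N λ c → outflows-∏ m (λ g → o g ℕ.+ c ℕ.* δ (toℕ i) g))
    (trans (∑⁻-∏ N (Fin.toℕ<n i) (λ g → fold (Θ g) (U N) (multiplicity g m)) o) (∏-cong k λ {g} _ →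
      sym (cong-app (fold-+ (Θ g) (U N) (δ (toℕ i) g)) (o g))))

  outflows-cong : ∀ m {o o′} → o ≗ o′ → outflows m o ≡ outflows m o′
  outflows-cong []      o≗o′ = ∏-cong k λ {g} _ → cong (Θ g) (o≗o′ g)
  outflows-cong (i ∷ m) o≗o′ = ∑⁻-cong N λ c →
    outflows-cong m λ g → cong (ℕ._+ c ℕ.* δ (toℕ i) g) (o≗o′ g)

  -- Balance is kept edge by edge, so at the end every truncated difference inside `ψ` is the
  -- recorded outflow.
  S≡outflows : ∀ m {s o} → (∀ g → Balanced m s o g) → S m s ≡ outflows (map t m) o
  S≡outflows []      {s} {o} bal = ∏-cong k λ {g} _ → cong (Θ g) (Balanced⇒∸ {s = s} {o} (bal g))
  S≡outflows (e ∷ m) {s} {o} bal = ∑⁻-cong N λ c →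
    trans (S≡outflows m (λ g → Balanced-∷ {s = s} {o} c (bal g)))
      (outflows-cong (map t m) λ g → cong (λ i → o g ℕ.+ c ℕ.* δ i g) (sym (toℕ-t e)))

  outflows-dual : ∀ m → length m ℕ.≤ D → length target ℕ.≤ D →
    outflows m (const 0) ≡ 𝟙[ m ↭? target ]
  outflows-dual m m≤D target≤D = trans (outflows-∏ m (const 0)) ∏≡
    where
    D<N : D ℕ.< N
    D<N = ℕ.m≤m+n (suc D) _
    mult≤D : ∀ g → multiplicity g m ℕ.≤ D
    mult≤D g = ℕ.≤-trans (multiplicity≤length g m) m≤D
    ∏≡ : ∏ k (λ g → fold (Θ g) (U N) (multiplicity g m) 0) ≡ 𝟙[ m ↭? target ]
    ∏≡ with m ↭? target
    ... | yes m↭ = ∏-one k λ {g} _ → U^-θ-≡ D<N (mult≤D g) (multiplicity-resp-↭ g m↭)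
    ... | no ¬m↭ with ℕ.anyUpTo? (λ g → ¬? (multiplicity g m ℕ.≟ multiplicity g target)) k
    -- Different multisets differ in some multiplicity, and the factor there vanishes by duality.
    ...   | yes (g , g<k , ≢) = ∏-zero _ g<k
            (U^-θ-≢ D<N (mult≤D g) (ℕ.≤-trans (multiplicity≤length g target) target≤D) ≢)
    ...   | no ∄ = contradiction (multiplicity⇒↭ m target λ {g} g<k →
            decidable-stable (multiplicity g m ℕ.≟ multiplicity g target) λ ≢ → ∄ (g , g<k , ≢)) ¬m↭

  S-irreducible : ∀ {m} → Irreducible m → length m ℕ.≤ D → length target ℕ.≤ D →
    S m (const 0) ≡ 𝟙[ map t m ↭? target ]
  S-irreducible {m} irr m≤D target≤D = trans (S≡outflows m (Irreducible⇒Balanced irr))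
    (outflows-dual (map t m) (subst (ℕ._≤ D) (sym (length-map t m)) m≤D) target≤D)

-- Formal sums of terms

lin : {V : Set} → (ℕ → Monomial V → ℚ) → Poly V → ℚ
lin w []               = 0ℚ
lin w (term c b m ∷ p) = c * w b m + lin w p

lin-++ : ∀ {V} (w : ℕ → Monomial V → ℚ) p q → lin w (p ++ q) ≡ lin w p + lin w q
lin-++ w []               q = sym (ℚ.+-identityˡ (lin w q))
lin-++ w (term c b m ∷ p) q = trans (cong (c * w b m +_) (lin-++ w p q))
  (sym (ℚ.+-assoc (c * w b m) (lin w p) (lin w q)))

lin-cong : ∀ {V} {w w′ : ℕ → Monomial V → ℚ} {p} →
  All (λ u → w (βpower u) (monomial u) ≡ w′ (βpower u) (monomial u)) p → lin w p ≡ lin w′ p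
lin-cong []                             = refl
lin-cong {p = term c b m ∷ p} (eq ∷ eqs) = cong₂ _+_ (cong (c *_) eq) (lin-cong eqs)

lin-substitute : ∀ {V W : Set} (f : V → W) w p →
  lin w (substitute f p) ≡ lin (λ b m → w b (map f m)) p
lin-substitute f w []               = refl
lin-substitute f w (term c b m ∷ p) = cong (c * w b (map f m) +_) (lin-substitute f w p)

negate : ∀ {V} → Poly V → Poly V
negate = map λ { (term c b m) → term (- c) b m }

lin-negate : ∀ {V} (w : ℕ → Monomial V → ℚ) p → lin w (negate p) ≡ - lin w p
lin-negate w []               = refl
lin-negate w (term c b m ∷ p) = trans (cong (- c * w b m +_) (lin-negate w p))
  (solve 3 (λ c v l → (:- c) :* v :+ (:- l) := :- (c :* v :+ l)) refl c (w b m) (lin w p))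
  where open +-*-Solver

Symmetric : {V : Set} → (ℕ → Monomial V → ℚ) → Set
Symmetric w = ∀ b {m m′} → m ↭ m′ → w b m ≡ w b m′

module _ {V : Set} (_≟_ : DecidableEquality V) where

  open PolyEquality _≟_

  indicator : ℕ → Monomial V → ℕ → Monomial V → ℚ
  indicator b m b′ m′ with (b′ ℕ.≟ b) ×-dec (m′ ↭? m)
  ... | yes _ = 1ℚ
  ... | no  _ = 0ℚ

  indicator-yes : ∀ {b m b′ m′} → b′ ≡ b → m′ ↭ m → indicator b m b′ m′ ≡ 1ℚ
  indicator-yes {b} {m} {b′} {m′} b′≡b m′↭m with (b′ ℕ.≟ b) ×-dec (m′ ↭? m)
  ... | yes _ = refl
  ... | no ¬p = contradiction (b′≡b , m′↭m) ¬p

  indicator-no : ∀ {b m b′ m′} → ¬ (b′ ≡ b × m′ ↭ m) → indicator b m b′ m′ ≡ 0ℚ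
  indicator-no {b} {m} {b′} {m′} ¬p with (b′ ℕ.≟ b) ×-dec (m′ ↭? m)
  ... | yes p = contradiction p ¬p
  ... | no  _ = refl

  indicator-symmetric : ∀ b m → Symmetric (indicator b m)
  indicator-symmetric b m b′ {m′} {m″} m′↭m″
    with (b′ ℕ.≟ b) ×-dec (m′ ↭? m) | (b′ ℕ.≟ b) ×-dec (m″ ↭? m)
  ... | yes _          | yes _          = refl
  ... | no  _          | no  _          = refl
  ... | yes (b′≡b , p) | no ¬p          = contradiction (b′≡b , ↭-trans (↭-sym m′↭m″) p) ¬p
  ... | no ¬p          | yes (b′≡b , p) = contradiction (b′≡b , ↭-trans m′↭m″ p) ¬p

  coeff≡lin : ∀ b m p → coeff b m p ≡ lin (indicator b m) p
  coeff≡lin b m []                 = refl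
  coeff≡lin b m (term c b′ m′ ∷ p) with (b′ ℕ.≟ b) ×-dec (m′ ↭? m)
  ... | yes _ = cong₂ _+_ (sym (ℚ.*-identityʳ c)) (coeff≡lin b m p)
  ... | no  _ = trans (coeff≡lin b m p)
    (sym (trans (cong (_+ lin (indicator b m) p) (ℚ.*-zeroʳ c)) (ℚ.+-identityˡ _)))

  -- Deleting a whole class of like terms at once drives the induction showing that symmetric
  -- functionals see only coefficients.
  remove : ℕ → Monomial V → Poly V → Poly V
  remove b m []                 = []
  remove b m (term c b′ m′ ∷ p) with (b′ ℕ.≟ b) ×-dec (m′ ↭? m)
  ... | yes _ = remove b m p
  ... | no  _ = term c b′ m′ ∷ remove b m p

  length-remove : ∀ b m p → length (remove b m p) ℕ.≤ length p
  length-remove b m []                 = z≤n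
  length-remove b m (term c b′ m′ ∷ p) with (b′ ℕ.≟ b) ×-dec (m′ ↭? m)
  ... | yes _ = ℕ.m≤n⇒m≤1+n (length-remove b m p)
  ... | no  _ = s≤s (length-remove b m p)

  remove-head : ∀ c b m p → remove b m (term c b m ∷ p) ≡ remove b m p
  remove-head c b m p with (b ℕ.≟ b) ×-dec (m ↭? m)
  ... | yes _ = refl
  ... | no ¬p = contradiction (refl , ↭-refl) ¬p

  lin-remove : ∀ {w} → Symmetric w → ∀ b m p → lin w p ≡ coeff b m p * w b m + lin w (remove b m p)
  lin-remove {w} w-sym b m []                 =
    sym (trans (cong (_+ 0ℚ) (ℚ.*-zeroˡ (w b m))) (ℚ.+-identityʳ 0ℚ))
  lin-remove {w} w-sym b m (term c b′ m′ ∷ p) with (b′ ℕ.≟ b) ×-dec (m′ ↭? m)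
  ... | yes (refl , m′↭m) = trans
    (cong₂ (λ v l → c * v + l) (w-sym b m′↭m) (lin-remove w-sym b m p))
    (solve 4 (λ c v q r → c :* v :+ (q :* v :+ r) := (c :+ q) :* v :+ r) refl
      c (w b m) (coeff b m p) (lin w (remove b m p)))
    where open +-*-Solver
  ... | no _ = trans
    (cong (c * w b′ m′ +_) (lin-remove w-sym b m p))
    (solve 3 (λ a q r → a :+ (q :+ r) := q :+ (a :+ r)) refl
      (c * w b′ m′) (coeff b m p * w b m) (lin w (remove b m p)))
    where open +-*-Solver

  -- Each coefficient is itself a symmetric functional, and the deleted class contributes its total
  -- coefficient, zero, to it.
  remove-zero : ∀ b m {p} → p ≈ [] → remove b m p ≈ []
  remove-zero b m {p} p≈0 b′ m′ = begin
      coeff b′ m′ (remove b m p)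
    ≡⟨ coeff≡lin b′ m′ (remove b m p) ⟩
      lin i (remove b m p)
    ≡⟨ trans (cong (_+ lin i (remove b m p)) (ℚ.*-zeroˡ (i b m))) (ℚ.+-identityˡ _) ⟨
      0ℚ * i b m + lin i (remove b m p)
    ≡⟨ cong (λ q → q * i b m + lin i (remove b m p)) (p≈0 b m) ⟨
      coeff b m p * i b m + lin i (remove b m p)
    ≡⟨ lin-remove (indicator-symmetric b′ m′) b m p ⟨
      lin i p
    ≡⟨ coeff≡lin b′ m′ p ⟨
      coeff b′ m′ p
    ≡⟨ p≈0 b′ m′ ⟩
      0ℚ ∎
    where
    open ≡-Reasoning
    i = indicator b′ m′

  -- Induction on a bound `l` for the length, since `remove` does not yield a sublist by pattern
  -- matching. The terms like the head contribute their total coefficient, zero.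
  lin-zero : ∀ {w} → Symmetric w → ∀ l p → length p ℕ.≤ l → p ≈ [] → lin w p ≡ 0ℚ
  lin-zero w-sym l       []                  _         p≈0 = refl
  lin-zero {w} w-sym (suc l) p@(term c b m ∷ p′) (s≤s p′≤l) p≈0 = begin
      lin w p
    ≡⟨ lin-remove w-sym b m p ⟩
      coeff b m p * w b m + lin w (remove b m p)
    ≡⟨ cong₂ (λ q r → q * w b m + lin w r) (p≈0 b m) (remove-head c b m p′) ⟩
      0ℚ * w b m + lin w (remove b m p′)
    ≡⟨ cong₂ _+_ (ℚ.*-zeroˡ (w b m)) (lin-zero w-sym l (remove b m p′)
         (ℕ.≤-trans (length-remove b m p′) p′≤l)
         (subst (_≈ []) (remove-head c b m p′) (remove-zero b m {p} p≈0))) ⟩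
      0ℚ ∎
    where open ≡-Reasoning

  lin-resp-≈ : ∀ {w} → Symmetric w → ∀ {p q} → p ≈ q → lin w p ≡ lin w q
  lin-resp-≈ {w} w-sym {p} {q} p≈q = begin
      lin w p
    ≡⟨ solve 2 (λ a b → a := (a :- b) :+ b) refl (lin w p) (lin w q) ⟩
      (lin w p - lin w q) + lin w q
    ≡⟨ cong (_+ lin w q) (trans (sym (lin-difference w))
         (lin-zero w-sym _ (p ++ negate q) ℕ.≤-refl difference≈0)) ⟩
      0ℚ + lin w q
    ≡⟨ ℚ.+-identityˡ (lin w q) ⟩
      lin w q ∎
    where
    open ≡-Reasoning
    open +-*-Solver
    lin-difference : ∀ w → lin w (p ++ negate q) ≡ lin w p - lin w q
    lin-difference w = trans (lin-++ w p (negate q)) (cong (lin w p +_) (lin-negate w q))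
    difference≈0 : (p ++ negate q) ≈ []
    difference≈0 b m = trans (coeff≡lin b m (p ++ negate q)) (trans (lin-difference (indicator b m))
      (trans (cong₂ _-_ (trans (sym (coeff≡lin b m p)) (p≈q b m)) (sym (coeff≡lin b m q)))
        (ℚ.+-inverseʳ (coeff b m q))))

-- Each coefficient of the image is a symmetric functional of the original polynomial.
substitute-resp-≈ : ∀ {V W : Set} (_≟ⱽ_ : DecidableEquality V) (_≟ᵂ_ : DecidableEquality W)
  (f : V → W) {p q} → PolyEquality._≈_ _≟ⱽ_ p q →
  PolyEquality._≈_ _≟ᵂ_ (substitute f p) (substitute f q)
substitute-resp-≈ _≟ⱽ_ _≟ᵂ_ f {p} {q} p≈q b m = begin
    coeff b m (substitute f p)                  ≡⟨ coeff≡lin _≟ᵂ_ b m (substitute f p) ⟩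
    lin (indicator _≟ᵂ_ b m) (substitute f p)   ≡⟨ lin-substitute f _ p ⟩
    lin w p                                     ≡⟨ lin-resp-≈ _≟ⱽ_ w-symmetric {p} {q} p≈q ⟩
    lin w q                                     ≡⟨ lin-substitute f _ q ⟨
    lin (indicator _≟ᵂ_ b m) (substitute f q)   ≡⟨ coeff≡lin _≟ᵂ_ b m (substitute f q) ⟨
    coeff b m (substitute f q)                  ∎
  where
  open ≡-Reasoning
  open PolyEquality _≟ᵂ_ using (coeff)
  w = λ b′ m′ → indicator _≟ᵂ_ b m b′ (map f m′)
  w-symmetric : Symmetric w
  w-symmetric b′ m′↭m″ = indicator-symmetric _≟ᵂ_ b m b′ (Perm.map⁺ f m′↭m″)

-- Invariants of reduction

module _ {n : ℕ} where

  -- These conditions say that `lin w` is a ℚ-linear functional on the subdivision algebra, given by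
  -- its values on the products βᵇ m.
  record IsValuation (w : ℕ → Monomial (Edge n) → ℚ) : Set where
    field
      symmetric : Symmetric w
      reduction : ∀ b {i j k : Fin n} (i<j : i Fin.< j) (j<k : j Fin.< k) r →
        let i<k = Fin.<-trans i<j j<k in
        w b (x i<j ∷ x j<k ∷ r) ≡
        w b (x i<k ∷ x i<j ∷ r) + w b (x i<k ∷ x j<k ∷ r) + w (suc b) (x i<k ∷ r)

  module _ {w : ℕ → Monomial (Edge n) → ℚ} (isValuation : IsValuation w) where

    open IsValuation isValuation

    lin-⟿ : ∀ {u q} → u ⟿ q → lin w (u ∷ []) ≡ lin w q
    lin-⟿ (reduce {c} {b} {m} i<j j<k r m↭) = trans
      (cong (λ v → c * v + 0ℚ) (trans (symmetric b m↭) (reduction b i<j j<k r)))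
      (solve 4 (λ c y z s → c :* (y :+ z :+ s) :+ con 0ℚ := c :* y :+ (c :* z :+ (c :* s :+ con 0ℚ)))
        refl c _ _ _)
      where open +-*-Solver

    lin-⟶ : ∀ {p q} → p ⟶ q → lin w p ≡ lin w q
    lin-⟶ (step ps qs {u} {q} u⟿q) = begin
        lin w (ps ++ u ∷ qs)
      ≡⟨ trans (lin-++ w ps (u ∷ qs)) (cong (lin w ps +_) (lin-++ w (u ∷ []) qs)) ⟩
        lin w ps + (lin w (u ∷ []) + lin w qs)
      ≡⟨ cong (λ v → lin w ps + (v + lin w qs)) (lin-⟿ u⟿q) ⟩
        lin w ps + (lin w q + lin w qs)
      ≡⟨ trans (lin-++ w ps (q ++ qs)) (cong (lin w ps +_) (lin-++ w q qs)) ⟨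
        lin w (ps ++ q ++ qs) ∎
      where open ≡-Reasoning

    lin-⟶* : ∀ {p q} → Star _⟶_ p q → lin w p ≡ lin w q
    lin-⟶* ε        = refl
    lin-⟶* (p ◅ ps) = trans (lin-⟶ p) (lin-⟶* ps)

    lin-concatMap : ∀ {f} → (∀ c b m → lin w (f (term c b m)) ≡ c * w b m) →
      ∀ p → lin w (concatMap f p) ≡ lin w p
    lin-concatMap     f≡ []               = refl
    lin-concatMap {f} f≡ (term c b m ∷ p) =
      trans (lin-++ w (f (term c b m)) (concatMap f p)) (cong₂ _+_ (f≡ c b m) (lin-concatMap f≡ p))

    module _ (j : Fin n) where

      open AtVertex j

      lin-singleton : ∀ c b m → lin w (term c b m ∷ []) ≡ c * w b m
      lin-singleton c b m = ℚ.+-identityʳ (c * w b m)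

      -- Each unfolding is one reduction of the two head edges, so `reduction` applies after
      -- reordering.
      lin-reduceTopmost : ∀ c b is ks r →
        lin w (reduceTopmost c b is ks r) ≡ c * w b (map xᴮ is ++ map xᴬ ks ++ r)
      lin-reduceTopmost c b []       ks r = lin-singleton c b _
      lin-reduceTopmost c b (_ ∷ _)  [] r = lin-singleton c b _
      lin-reduceTopmost c b is₀@(i@(_ , i<j) ∷ is) ks₀@(k@(_ , j<k) ∷ ks) r = begin
          lin w (p₁ ++ p₂ ++ p₃)
        ≡⟨ trans (lin-++ w p₁ (p₂ ++ p₃)) (cong (lin w p₁ +_) (lin-++ w p₂ p₃)) ⟩
          lin w p₁ + (lin w p₂ + lin w p₃)
        ≡⟨ cong₂ _+_ (lin-reduceTopmost c b is₀ ks (e ∷ r))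
             (cong₂ _+_ (lin-reduceTopmost c b is ks₀ (e ∷ r))
               (lin-reduceTopmost c (suc b) is ks (e ∷ r))) ⟩
          c * w b (map xᴮ is₀ ++ map xᴬ ks ++ e ∷ r) +
            (c * w b (map xᴮ is ++ map xᴬ ks₀ ++ e ∷ r) +
             c * w (suc b) (map xᴮ is ++ map xᴬ ks ++ e ∷ r))
        ≡⟨ cong₂ (λ u v → c * u + v) (symmetric b ↭₁)
             (cong₂ (λ u v → c * u + c * v) (symmetric b ↭₂) (symmetric (suc b) ↭₃)) ⟩
          c * w b (e ∷ xᴮ i ∷ rest) + (c * w b (e ∷ xᴬ k ∷ rest) + c * w (suc b) (e ∷ rest))
        ≡⟨ solve 4 (λ c y z s → c :* y :+ (c :* z :+ c :* s) := c :* (y :+ z :+ s)) refl c _ _ _ ⟩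
          c * (w b (e ∷ xᴮ i ∷ rest) + w b (e ∷ xᴬ k ∷ rest) + w (suc b) (e ∷ rest))
        ≡⟨ cong (c *_) (trans (symmetric b ↭₀) (reduction b i<j j<k rest)) ⟨
          c * w b (map xᴮ is₀ ++ map xᴬ ks₀ ++ r) ∎
        where
        open ≡-Reasoning
        open +-*-Solver
        e    = x (Fin.<-trans i<j j<k)
        rest = map xᴮ is ++ map xᴬ ks ++ r
        p₁   = reduceTopmost c b is₀ ks (e ∷ r)
        p₂   = reduceTopmost c b is ks₀ (e ∷ r)
        p₃   = reduceTopmost c (suc b) is ks (e ∷ r)
        -- `↭₀` exposes the pair to be reduced; `↭₁`, `↭₂` and `↭₃` belong to the three summands of
        -- the result.
        ↭₀ : map xᴮ is₀ ++ map xᴬ ks₀ ++ r ↭ xᴮ i ∷ xᴬ k ∷ rest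
        ↭₀ = ↭-prep (xᴮ i) (Perm.shift (xᴬ k) (map xᴮ is) (map xᴬ ks ++ r))
        ↭₃ : map xᴮ is ++ map xᴬ ks ++ e ∷ r ↭ e ∷ rest
        ↭₃ = ↭-trans (Perm.++⁺ˡ (map xᴮ is) (Perm.shift e (map xᴬ ks) r))
          (Perm.shift e (map xᴮ is) (map xᴬ ks ++ r))
        ↭₁ : map xᴮ is₀ ++ map xᴬ ks ++ e ∷ r ↭ e ∷ xᴮ i ∷ rest
        ↭₁ = ↭-trans (↭-prep (xᴮ i) ↭₃) (↭-swap (xᴮ i) e ↭-refl)
        ↭₂ : map xᴮ is ++ map xᴬ ks₀ ++ e ∷ r ↭ e ∷ xᴬ k ∷ rest
        ↭₂ = ↭-trans (Perm.shift (xᴬ k) (map xᴮ is) (map xᴬ ks ++ e ∷ r))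
          (↭-trans (↭-prep (xᴬ k) ↭₃) (↭-swap (xᴬ k) e ↭-refl))

-- The canonical reduced form

module _ {n : ℕ} (j : Fin n) where

  open AtVertex j

  partition : ∀ m → m ↭ map xᴮ (mapMaybe below? m) ++ map xᴬ (mapMaybe above? m) ++ elsewhere m
  partition []                  = ↭-refl
  partition (edge {i} {k} i<k ∷ m) with k Fin.≟ j | i Fin.≟ j
  -- Such an edge would be a loop at `j`.
  ... | yes refl | yes refl = contradiction i<k (ℕ.<-irrefl refl)
  ... | yes refl | no  _    = ↭-prep _ (partition m)
  ... | no  _    | yes refl = ↭-trans (↭-prep _ (partition m))
    (↭-sym (Perm.shift _ (map xᴮ (mapMaybe below? m)) _))
  ... | no  _    | no  _    = ↭-trans (↭-prep _ (partition m)) (↭-sym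
    (↭-trans (Perm.++⁺ˡ (map xᴮ (mapMaybe below? m)) (Perm.shift _ (map xᴬ (mapMaybe above? m)) _))
      (Perm.shift _ (map xᴮ (mapMaybe below? m)) _)))

  partition-sorted : ∀ m → m ↭ map xᴮ (incoming m) ++ map xᴬ (outgoing m) ++ elsewhere m
  partition-sorted m = ↭-trans (partition m) (↭-sym
    (Perm.++⁺ (Perm.map⁺ xᴮ (InsertionSort.sort-↭ ≤ᴮ (mapMaybe below? m)))
      (Perm.++⁺ʳ (elsewhere m) (Perm.map⁺ xᴬ (InsertionSort.sort-↭ ≥ᴬ (mapMaybe above? m))))))

  lin-reduceAt : ∀ {w} → IsValuation w → ∀ c b m → lin w (reduceAt (term c b m)) ≡ c * w b m
  lin-reduceAt isVal c b m =
    trans (lin-reduceTopmost isVal j c b (incoming m) (outgoing m) (elsewhere m))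
      (cong (c *_) (sym (IsValuation.symmetric isVal b (partition-sorted m))))

lin-Crf : ∀ {n} {w : ℕ → Monomial (Edge n) → ℚ} → IsValuation w →
  ∀ vs p → lin w (foldl (λ p j → concatMap (AtVertex.reduceAt j) p) p vs) ≡ lin w p
lin-Crf isVal []       p = refl
lin-Crf isVal (v ∷ vs) p = trans (lin-Crf isVal vs (concatMap (AtVertex.reduceAt v) p))
  (lin-concatMap isVal (lin-reduceAt v isVal) p)

-- Irreducibility of the canonical reduced form

Within : ∀ {n} → List (Fin n) → List (Fin n) → Monomial (Edge n) → Set
Within ss ts = All λ e → src e ∈ ss × tgt e ∈ ts

Unpassable : ∀ {n} → Fin n → Monomial (Edge n) → Set
Unpassable v m = All (λ e → tgt e ≢ v) m ⊎ All (λ e → src e ≢ v) m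

-- A reduction creates no new source or target, as x_ik inherits `i` from x_ij and `k` from x_jk;
-- hence a vertex already treated stays unpassable.
Unpassable-within : ∀ {n} {v : Fin n} {m m′} →
  Within (map src m) (map tgt m) m′ → Unpassable v m → Unpassable v m′
Unpassable-within within (inj₁ tgt≢v) = inj₁ (All.map (All.lookup (All.map⁺ tgt≢v) ∘ proj₂) within)
Unpassable-within within (inj₂ src≢v) = inj₂ (All.map (All.lookup (All.map⁺ src≢v) ∘ proj₁) within)

Unpassable⇒Irreducible : ∀ {n} {m : Monomial (Edge n)} → (∀ v → Unpassable v m) → Irreducible m
Unpassable⇒Irreducible unp {e} e∈m f∈m tgt≡src with unp (tgt e)
... | inj₁ tgt≢ = All.lookup tgt≢ e∈m refl
... | inj₂ src≢ = All.lookup src≢ f∈m (sym tgt≡src)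

module _ {n : ℕ} (j : Fin n) where

  open AtVertex j

  module _ {ss ts : List (Fin n)} where

    reduceTopmost-within : ∀ c b is ks r →
      Within ss ts (map xᴮ is) → Within ss ts (map xᴬ ks) → Within ss ts r →
      All (Within ss ts ∘ monomial) (reduceTopmost c b is ks r)
    reduceTopmost-within c b []      ks r isᵂ ksᵂ rᵂ = All.++⁺ ksᵂ rᵂ ∷ []
    reduceTopmost-within c b (_ ∷ _) [] r isᵂ ksᵂ rᵂ = All.++⁺ isᵂ rᵂ ∷ []
    reduceTopmost-within c b (i ∷ is) (k ∷ ks) r isᵂ₀@((i∈ , _) ∷ isᵂ) ksᵂ₀@((_ , k∈) ∷ ksᵂ) rᵂ =
      All.++⁺ (reduceTopmost-within c b (i ∷ is) ks _ isᵂ₀ ksᵂ ((i∈ , k∈) ∷ rᵂ))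
        (All.++⁺ (reduceTopmost-within c b is (k ∷ ks) _ isᵂ ksᵂ₀ ((i∈ , k∈) ∷ rᵂ))
          (reduceTopmost-within c (suc b) is ks _ isᵂ ksᵂ ((i∈ , k∈) ∷ rᵂ)))

  tgt-xᴬ≢ : ∀ ks → All (λ e → tgt e ≢ j) (map xᴬ ks)
  tgt-xᴬ≢ ks = All.map⁺ (All.universal (λ { (k , j<k) refl → ℕ.<-irrefl refl j<k }) ks)

  src-xᴮ≢ : ∀ is → All (λ e → src e ≢ j) (map xᴮ is)
  src-xᴮ≢ is = All.map⁺ (All.universal (λ { (i , i<j) refl → ℕ.<-irrefl refl i<j }) is)

  -- The recursion stops when the edges into `j` or those out of `j` are used up, and the new edges
  -- x_ik miss `j`.
  reduceTopmost-unpassable : ∀ c b is ks r →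
    All (λ e → tgt e ≢ j) r → All (λ e → src e ≢ j) r →
    All (Unpassable j ∘ monomial) (reduceTopmost c b is ks r)
  reduceTopmost-unpassable c b []         ks r tgt≢ src≢ = inj₁ (All.++⁺ (tgt-xᴬ≢ ks) tgt≢) ∷ []
  reduceTopmost-unpassable c b is@(_ ∷ _) [] r tgt≢ src≢ = inj₂ (All.++⁺ (src-xᴮ≢ is) src≢) ∷ []
  reduceTopmost-unpassable c b (i@(_ , i<j) ∷ is) (k@(_ , j<k) ∷ ks) r tgt≢ src≢ =
    All.++⁺ (reduceTopmost-unpassable c b (i ∷ is) ks _ tgt≢′ src≢′)
      (All.++⁺ (reduceTopmost-unpassable c b is (k ∷ ks) _ tgt≢′ src≢′)
        (reduceTopmost-unpassable c (suc b) is ks _ tgt≢′ src≢′))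
    where
    tgt≢′ = (λ { refl → ℕ.<-irrefl refl j<k }) ∷ tgt≢
    src≢′ = (λ { refl → ℕ.<-irrefl refl i<j }) ∷ src≢

  reduceAt-within : ∀ u →
    All (Within (map src (monomial u)) (map tgt (monomial u)) ∘ monomial) (reduceAt u)
  reduceAt-within (term c b m)
    with isᵂ , rest ← All.++⁻ (map xᴮ (incoming m)) (Perm.All-resp-↭ (partition-sorted j m)
           (All.tabulate λ e∈m → ∈-map⁺ src e∈m , ∈-map⁺ tgt e∈m))
    with ksᵂ , rᵂ ← All.++⁻ (map xᴬ (outgoing m)) rest =
    reduceTopmost-within c b (incoming m) (outgoing m) (elsewhere m) isᵂ ksᵂ rᵂ

  reduceAt-unpassable : ∀ u → All (Unpassable j ∘ monomial) (reduceAt u)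
  reduceAt-unpassable (term c b m) =
    reduceTopmost-unpassable c b (incoming m) (outgoing m) (elsewhere m)
      (All.map proj₁ ≢j) (All.map proj₂ ≢j)
    where ≢j = All.all-filter _ m

All-concatMap : ∀ {A B : Set} {P : A → Set} {Q : B → Set} {f : A → List B} →
  (∀ {a} → P a → All Q (f a)) → ∀ {as} → All P as → All Q (concatMap f as)
All-concatMap h ps = All.concat⁺ (All.map⁺ (All.map h ps))

-- The invariant is that `v` is already unpassable or still to be visited. It holds for any order of
-- visits, which serves both directions.
Crf-unpassable : ∀ {n} {v : Fin n} vs p → All (Unpassable v ∘ monomial) p ⊎ v ∈ vs →
  All (Unpassable v ∘ monomial) (foldl (λ p j → concatMap (AtVertex.reduceAt j) p) p vs)
Crf-unpassable []       p (inj₁ unp) = unp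
Crf-unpassable (v ∷ vs) p (inj₁ unp) = Crf-unpassable vs _ (inj₁ (All-concatMap
  (λ {u} unp → All.map (λ within → Unpassable-within within unp) (reduceAt-within v u)) unp))
Crf-unpassable (v ∷ vs) p (inj₂ (here refl)) = Crf-unpassable vs _ (inj₁ (All-concatMap
  (λ {u} _ → reduceAt-unpassable v u) (All.universal (λ _ → tt) p)))
Crf-unpassable (_ ∷ vs) p (inj₂ (there v∈vs)) = Crf-unpassable vs _ (inj₂ v∈vs)

∈-vertices : ∀ {n} d (v : Fin n) → v ∈ vertices d
∈-vertices frontToBack v = ∈-allFin v
∈-vertices backToFront v = Any.reverse⁺ (∈-allFin v)

Crf-irreducible : ∀ {n} d (T : Graph n) → All (Irreducible ∘ monomial) (Crf d T)
Crf-irreducible d T = All.tabulate λ u∈ → Unpassable⇒Irreducible λ v →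
  All.lookup (Crf-unpassable (vertices d) (monomialPoly m[ T ]) (inj₂ (∈-vertices d v))) u∈

-- Reading off a coefficient

module _ {n : ℕ} (b : ℕ) (target : Monomial (Fin (pred n))) where

  private D = b ℕ.+ length target

  open Evaluation {n} D target

  -- The reduction relations are homogeneous when β has degree 1, so only the
  -- terms of the degree D of βᵇ target matter.
  valuation : ℕ → Monomial (Edge n) → ℚ
  valuation b′ m = 𝟙[ b′ ℕ.+ length m ℕ.≟ D ] * S m (const 0)

  valuation-isValuation : IsValuation valuation
  valuation-isValuation = record
    { symmetric = λ b′ m↭m′ →
        cong₂ (λ l s → 𝟙[ b′ ℕ.+ l ℕ.≟ D ] * s) (Perm.↭-length m↭m′) (S-resp-↭ m↭m′ (const 0))
    ; reduction = reduction
    }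
    where
    S₀ : Monomial (Edge n) → ℚ
    S₀ m = S m (const 0)
    reduction : ∀ b′ {i j k : Fin n} (i<j : i Fin.< j) (j<k : j Fin.< k) r →
      let i<k = Fin.<-trans i<j j<k in
      valuation b′ (x i<j ∷ x j<k ∷ r) ≡
      valuation b′ (x i<k ∷ x i<j ∷ r) + valuation b′ (x i<k ∷ x j<k ∷ r)
        + valuation (suc b′) (x i<k ∷ r)
    reduction b′ i<j j<k r = begin
        q * S₀ (x i<j ∷ x j<k ∷ r)
      ≡⟨ cong (q *_) (S-reduce i<j j<k r (const 0)) ⟩
        q * (S₀ (e ∷ x i<j ∷ r) + S₀ (e ∷ x j<k ∷ r) + S₀ (e ∷ r))
      ≡⟨ solve 4 (λ q y z s → q :* (y :+ z :+ s) := q :* y :+ q :* z :+ q :* s) refl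
           q (S₀ (e ∷ x i<j ∷ r)) (S₀ (e ∷ x j<k ∷ r)) (S₀ (e ∷ r)) ⟩
        q * S₀ (e ∷ x i<j ∷ r) + q * S₀ (e ∷ x j<k ∷ r) + q * S₀ (e ∷ r)
      -- The last summand has one edge fewer but one more factor β, hence the same degree.
      ≡⟨ cong (λ l → q * S₀ (e ∷ x i<j ∷ r) + q * S₀ (e ∷ x j<k ∷ r) + 𝟙[ l ℕ.≟ D ] * S₀ (e ∷ r))
           (ℕ.+-suc b′ (suc (length r))) ⟩
        valuation b′ (e ∷ x i<j ∷ r) + valuation b′ (e ∷ x j<k ∷ r) + valuation (suc b′) (e ∷ r) ∎
      where
      open ≡-Reasoning
      open +-*-Solver
      e = x (Fin.<-trans i<j j<k)
      q = 𝟙[ b′ ℕ.+ suc (suc (length r)) ℕ.≟ D ]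

  valuation-irreducible : ∀ b′ {m} → Irreducible m →
    valuation b′ m ≡ indicator Fin._≟_ b target b′ (map t m)
  valuation-irreducible b′ {m} irr = cases (b′ ℕ.+ length m ℕ.≟ D) (map t m ↭? target)
    where
    open PolyEquality (Fin._≟_ {pred n}) using (_↭?_)
    length≡ : map t m ↭ target → length m ≡ length target
    length≡ p = trans (sym (length-map t m)) (Perm.↭-length p)
    cases : Dec (b′ ℕ.+ length m ≡ D) → Dec (map t m ↭ target) →
      valuation b′ m ≡ indicator Fin._≟_ b target b′ (map t m)
    cases (no ≢D) _ = trans (cong (_* S m (const 0)) (𝟙-no (b′ ℕ.+ length m ℕ.≟ D) ≢D))
      (trans (ℚ.*-zeroˡ (S m (const 0)))
        (sym (indicator-no Fin._≟_ {b} {target} {b′} λ (b′≡b , p) →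
          ≢D (cong₂ ℕ._+_ b′≡b (length≡ p)))))
    cases (yes ≡D) m↭? = trans
      (cong₂ _*_ (𝟙-yes (b′ ℕ.+ length m ℕ.≟ D) ≡D)
        (S-irreducible irr (subst (length m ℕ.≤_) ≡D (ℕ.m≤n+m (length m) b′))
          (ℕ.m≤n+m (length target) b)))
      (trans (ℚ.*-identityˡ 𝟙[ map t m ↭? target ]) (indicator≡ m↭?))
      where
      indicator≡ : Dec (map t m ↭ target) →
        𝟙[ map t m ↭? target ] ≡ indicator Fin._≟_ b target b′ (map t m)
      -- Matching monomials have equal lengths, so the degree `D` forces `b′ ≡ b`.
      indicator≡ (yes p) = trans (𝟙-yes (map t m ↭? target) p) (sym (indicator-yes Fin._≟_
        (ℕ.+-cancelʳ-≡ (length target) b′ b (trans (cong (b′ ℕ.+_) (sym (length≡ p))) ≡D)) p))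
      indicator≡ (no ¬p) = trans (𝟙-no (map t m ↭? target) ¬p)
        (sym (indicator-no Fin._≟_ {b} {target} {b′} (¬p ∘ proj₂)))

coeff-setTo-t : ∀ {n} b target {p : Poly (Edge n)} → All (Irreducible ∘ monomial) p →
  PolyEquality.coeff Fin._≟_ b target (setTo-t p) ≡ lin (valuation {n} b target) p
coeff-setTo-t b target {p} irr = trans (coeff≡lin Fin._≟_ b target (setTo-t p))
  (trans (lin-substitute t _ p)
    (lin-cong (All.map {P = Irreducible ∘ monomial} (λ {u} irr →
      sym (valuation-irreducible b target (βpower u) irr)) irr)))

theorem5p1 : (n : ℕ) (T : Graph n) → IsTree T → Noncrossing T →
    (R : Poly (Edge n)) → IsReducedForm m[ T ] R →
    (d : Direction) →
    setTo-t R ≈ₜ setTo-t (Crf d T)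
theorem5p1 n T _ _ R (p , m⟶*p , p-irr , R≈p) d b m = begin
    coeff b m (setTo-t R)            ≡⟨ substitute-resp-≈ _≟ᴱ_ Fin._≟_ t {R} {p} R≈p b m ⟩
    coeff b m (setTo-t p)            ≡⟨ coeff-setTo-t b m p-irr ⟩
    -- Both irreducible polynomials descend from m[T] by reductions, so the functional that reads
    -- off this coefficient takes the same value on them.
    lin w p                          ≡⟨ lin-⟶* isVal m⟶*p ⟨
    lin w (monomialPoly m[ T ])      ≡⟨ lin-Crf isVal (vertices d) (monomialPoly m[ T ]) ⟨
    lin w (Crf d T)                  ≡⟨ coeff-setTo-t b m (Crf-irreducible d T) ⟨
    coeff b m (setTo-t (Crf d T))    ∎
  where
  open ≡-Reasoning
  open PolyEquality (Fin._≟_ {pred n}) using (coeff)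
  w = valuation b m
  isVal = valuation-isValuation b m
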